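{- Let $m\ge 3$. Then $$\mathcal{G}(\mathcal{D}_m) = \mathrm{mex}\{x_3,x_4,\dots,x_{m-2}\},$$ where $x_i=\mathcal{G}(\mathcal{H}_i)\oplus\mathcal{G}(\mathcal{D}_{m+1-i})$ for $i \in \{3,4,\dots,m-2\}$.
   Context: Toggle: Let $G$ be a finite simple graph, with $N[v]$ the closed neighborhood of $v$. A position $\{G,V_0\}$ consists of $G$ and a set $V_0\subseteq V(G)$ of vertices of weight $0$; all other vertices have weight $1$. Let $\sigma(v)$ be the sum of the weights of the vertices in $N[v]$. A legal move consists of choosing a vertex $v$ of weight $1$ and switching the weight ($0\leftrightarrow 1$) of every vertex of $N[v]$; it is allowed only if $\sigma(v)$ after the switch is strictly smaller than $\sigma(v)$ before it. Two players alternate legal moves; a player with no legal move loses. Nimbers: $\mathcal{G}(\mathcal{S})=\mathrm{mex}\{\mathcal{G}(\mathcal{S}') : \mathcal{S}' \text{ reachable from } \mathcal{S} \text{ by one legal move}\}$, where $\mathrm{mex}(T)$ is the least nonnegative integer not in the finite set $T$ (so $\mathrm{mex}(\emptyset)=0$; lists with upper index less than $3$ are empty). $\oplus$ denotes bitwise XOR of nonnegative integers. $\mathcal{L}_{2,m}$ is the $2\times m$ grid graph with vertices $v_{i,j}$, $0\le i\le 1$, $1\le j\le m$, with edges $v_{0,j}v_{1,j}$ and $v_{i,j}v_{i,j+1}$ ($1\le j<m$). For $m\ge 4$, $\mathcal{H}_m=\{\mathcal{L}_{2,m},V_0\}$ with $V_0=\{v_{0,1},v_{0,m},v_{1,1},v_{1,2},v_{1,m-1},v_{1,m}\}$;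 $\mathcal{H}_3=\{\mathcal{L}_{2,3},V_0\}$ with $V_0=\{v_{0,1},v_{0,3},v_{1,1},v_{1,3}\}$. For $m\ge 3$, $\mathcal{D}_m=\{\mathcal{L}_{2,m},V_0\}$ with $V_0=\{v_{0,1},v_{0,m-1},v_{0,m},v_{1,1},v_{1,2},v_{1,m}\}$. -}

module Defs where

open import Data.Bool using (Bool; true; false; not; if_then_else_)
open import Data.Fin using (Fin; toℕ)
open import Data.Fin.Patterns using (0F; 1F)
import Data.Fin.Properties as Fin
open import Data.List using (List; []; _∷_; map; filter; foldr; mapMaybe; upTo; allFin; cartesianProduct)
open import Data.List.Properties using (map-cong)
open import Data.List.Membership.Propositional using (_∈_; _∉_)
open import Data.List.Membership.Propositional.Properties using (∈-allFin; ∈-cartesianProduct⁺)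
import Data.List.Membership.DecPropositional as DecMembership
open import Data.List.Relation.Unary.Any using (here; there)
open import Data.List.Relation.Unary.Unique.Propositional using (Unique)
open import Data.List.Relation.Unary.Unique.Propositional.Properties using (allFin⁺; cartesianProduct⁺)
import Data.Maybe as Maybe
open import Data.Nat using (ℕ; zero; suc; _+_; _*_; _∸_; _⊔_; _≤_; _<_; z≤n; s≤s; s≤s⁻¹)
open import Data.Nat.DivMod using (_/_; _%_; m/n<m; m/n≤m; m%n<n; m%n%n≡m%n; [m+kn]%n≡m%n; +-distrib-/-∣ʳ; m*n/n≡m; m<n⇒m/n≡0)
open import Data.Nat.Divisibility using (m∣m*n)
open import Data.Nat.Induction using (<-wellFounded)
open import Data.Nat.Properties
open import Data.Nat.ListAction using (sum)
open import Data.Product using (∃; _×_; _,_)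
open import Data.Product.Properties using (≡-dec)
open import Data.Sum using (_⊎_; inj₁; inj₂; swap; [_,_])
open import Induction.WellFounded using (Acc; acc)
open import Relation.Binary using (Decidable; DecidableEquality; Symmetric)
open import Relation.Binary.PropositionalEquality using (_≡_; refl; sym; trans; cong; cong₂; subst; module ≡-Reasoning)
open import Relation.Nullary.Decidable using (dec-false; dec⇒maybe)
open import Relation.Nullary using (¬_; Dec; yes; no; does; _×-dec_; _⊎-dec_)

module ℕ-∈ = DecMembership _≟_

mexFrom : List ℕ → ℕ → ℕ → ℕ
mexFrom xs k zero = k
mexFrom xs k (suc f) = if does (k ℕ-∈.∈? xs) then mexFrom xs (suc k) f else k

-- All elements of xs are smaller than the search bound, so the search never
-- stops early; see mex-∉ and mex-least.
mex : List ℕ → ℕ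
mex xs = mexFrom xs 0 (suc (foldr _⊔_ 0 xs))

private
  ∈⇒≤max : ∀ {k} xs → k ∈ xs → k ≤ foldr _⊔_ 0 xs
  ∈⇒≤max (x ∷ xs) (here refl) = m≤m⊔n x _
  ∈⇒≤max (x ∷ xs) (there p) = ≤-trans (∈⇒≤max xs p) (m≤n⊔m x _)

  mexFrom-∉ : ∀ xs k f → foldr _⊔_ 0 xs < k + f → mexFrom xs k f ∉ xs
  mexFrom-∉ xs k zero b p =
    <⇒≱ (subst (foldr _⊔_ 0 xs <_) (+-identityʳ k) b) (∈⇒≤max xs p)
  mexFrom-∉ xs k (suc f) b with k ℕ-∈.∈? xs
  ... | yes _ = mexFrom-∉ xs (suc k) f (subst (foldr _⊔_ 0 xs <_) (+-suc k f) b)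
  ... | no k∉ = k∉

  mexFrom-least : ∀ xs k f → (∀ {j} → j < k → j ∈ xs) → ∀ {j} → j < mexFrom xs k f → j ∈ xs
  mexFrom-least xs k zero below = below
  mexFrom-least xs k (suc f) below with k ℕ-∈.∈? xs
  ... | no _ = below
  ... | yes k∈ = mexFrom-least xs (suc k) f λ j<1+k →
    [ below , (λ { refl → k∈ }) ] (m<1+n⇒m<n∨m≡n j<1+k)

mex-∉ : ∀ xs → mex xs ∉ xs
mex-∉ xs = mexFrom-∉ xs 0 (suc (foldr _⊔_ 0 xs)) ≤-refl

mex-least : ∀ xs {j} → j < mex xs → j ∈ xs
mex-least xs = mexFrom-least xs 0 (suc (foldr _⊔_ 0 xs)) λ ()

xorBits : ℕ → ℕ → ℕ → ℕ
xorBits zero m n = 0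
xorBits (suc f) m n = (m % 2 + n % 2) % 2 + 2 * xorBits f (m / 2) (n / 2)

-- Bitwise XOR. The first argument of xorBits bounds the number of binary digits
-- processed; m + n of them always suffice, see ⊕-%2 and ⊕-/2.
infixl 6 _⊕_
_⊕_ : ℕ → ℕ → ℕ
m ⊕ n = xorBits (m + n) m n

private
  xorBits-00 : ∀ f → xorBits f 0 0 ≡ 0
  xorBits-00 zero = refl
  xorBits-00 (suc f) rewrite xorBits-00 f = refl

  half-bound : ∀ {f} m n → m + n ≤ suc f → m / 2 + n / 2 ≤ f
  half-bound zero zero _ = z≤n
  half-bound zero n@(suc _) b = s≤s⁻¹ (≤-trans (m/n<m n 2 (s≤s (s≤s z≤n))) b)
  half-bound m@(suc _) n b =
    s≤s⁻¹ (≤-trans (+-mono-≤ (m/n<m m 2 (s≤s (s≤s z≤n))) (m/n≤m n 2)) b)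

  xorBits-fuel : ∀ f g m n → m + n ≤ f → m + n ≤ g → xorBits f m n ≡ xorBits g m n
  xorBits-fuel zero g zero zero _ _ = sym (xorBits-00 g)
  xorBits-fuel (suc f) zero zero zero _ _ = xorBits-00 (suc f)
  xorBits-fuel (suc f) (suc g) m n b c =
    cong (λ x → (m % 2 + n % 2) % 2 + 2 * x)
      (xorBits-fuel f g (m / 2) (n / 2) (half-bound m n b) (half-bound m n c))

⊕-step : ∀ m n → m ⊕ n ≡ (m % 2 + n % 2) % 2 + 2 * (m / 2 ⊕ n / 2)
⊕-step m n = trans
  (xorBits-fuel (m + n) (suc (m + n)) m n ≤-refl (n≤1+n _))
  (cong (λ x → (m % 2 + n % 2) % 2 + 2 * x)
    (xorBits-fuel (m + n) _ (m / 2) (n / 2) (half-bound m n (n≤1+n _)) ≤-refl))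

⊕-%2 : ∀ m n → (m ⊕ n) % 2 ≡ (m % 2 + n % 2) % 2
⊕-%2 m n = begin
  (m ⊕ n) % 2        ≡⟨ cong (_% 2) (⊕-step m n) ⟩
  (b + 2 * q) % 2    ≡⟨ cong (λ x → (b + x) % 2) (*-comm 2 q) ⟩
  (b + q * 2) % 2    ≡⟨ [m+kn]%n≡m%n b q 2 ⟩
  b % 2              ≡⟨ m%n%n≡m%n (m % 2 + n % 2) 2 ⟩
  b                  ∎
  where
  open ≡-Reasoning
  b q : ℕ
  b = (m % 2 + n % 2) % 2
  q = m / 2 ⊕ n / 2

⊕-/2 : ∀ m n → (m ⊕ n) / 2 ≡ m / 2 ⊕ n / 2
⊕-/2 m n = begin
  (m ⊕ n) / 2            ≡⟨ cong (_/ 2) (⊕-step m n) ⟩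
  (b + 2 * q) / 2        ≡⟨ +-distrib-/-∣ʳ b (m∣m*n q) ⟩
  b / 2 + 2 * q / 2      ≡⟨ cong₂ _+_ (m<n⇒m/n≡0 (m%n<n (m % 2 + n % 2) 2))
                                      (trans (cong (_/ 2) (*-comm 2 q)) (m*n/n≡m q 2)) ⟩
  q                      ∎
  where
  open ≡-Reasoning
  b q : ℕ
  b = (m % 2 + n % 2) % 2
  q = m / 2 ⊕ n / 2

record Graph : Set₁ where
  field
    Vertex   : Set
    _≟ᵛ_     : DecidableEquality Vertex
    vertices : List Vertex
    complete : ∀ v → v ∈ vertices
    unique   : Unique vertices
    Adj      : Vertex → Vertex → Set
    adj?     : Decidable Adj
    adj-sym  : Symmetric Adj
    loopless : ∀ v → ¬ Adj v v

  -- InN[ v ] w : the vertex w lies in the closed neighbourhood N[v].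
  InN[_] : Vertex → Vertex → Set
  InN[ v ] w = w ≡ v ⊎ Adj v w

  inN[_]? : ∀ v w → Dec (InN[ v ] w)
  inN[ v ]? w = (w ≟ᵛ v) ⊎-dec adj? v w

  N[_] : Vertex → List Vertex
  N[ v ] = filter inN[ v ]? vertices

-- V₀ is given by its characteristic function.
record Position : Set₁ where
  constructor ⟨_,_⟩
  field
    graph : Graph
    V₀    : Graph.Vertex graph → Bool

module Toggle (G : Graph) where
  open Graph G

  weight : (Vertex → Bool) → Vertex → ℕ
  weight V₀ v = if V₀ v then 0 else 1

  σ : (Vertex → Bool) → Vertex → ℕ
  σ V₀ v = sum (map (weight V₀) N[ v ])

  toggle : (Vertex → Bool) → Vertex → (Vertex → Bool)
  toggle V₀ v w = if does (inN[ v ]? w) then not (V₀ w) else V₀ w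

  Legal : (Vertex → Bool) → Vertex → Set
  Legal V₀ v = weight V₀ v ≡ 1 × σ (toggle V₀ v) v < σ V₀ v

  legal? : ∀ V₀ v → Dec (Legal V₀ v)
  legal? V₀ v = (weight V₀ v ≟ 1) ×-dec (σ (toggle V₀ v) v <? σ V₀ v)

  legalMoves : ∀ V₀ → List (∃ (Legal V₀))
  legalMoves V₀ = mapMaybe (λ v → Maybe.map (v ,_) (dec⇒maybe (legal? V₀ v))) vertices

  total : (Vertex → Bool) → ℕ
  total V₀ = sum (map (weight V₀) vertices)

  private
    exchange : ∀ a b {s t s′ t′} → s + t ≡ s′ + t′ → (a + s) + (b + t) ≡ (b + s′) + (a + t′)
    exchange a b {s} {t} {s′} {t′} eq = begin
      (a + s) + (b + t)    ≡⟨ interchange a s b t ⟩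
      (a + b) + (s + t)    ≡⟨ cong₂ _+_ (+-comm a b) eq ⟩
      (b + a) + (s′ + t′)  ≡⟨ interchange b a s′ t′ ⟩
      (b + s′) + (a + t′)  ∎
      where
      open ≡-Reasoning
      open import Algebra.Properties.CommutativeSemigroup +-commutativeSemigroup using (interchange)

    balance : ∀ {P : Vertex → Set} (P? : ∀ w → Dec (P w)) (f g : Vertex → ℕ) → (∀ w → ¬ P w → f w ≡ g w) → ∀ xs →
      sum (map f xs) + sum (map g (filter P? xs)) ≡ sum (map g xs) + sum (map f (filter P? xs))
    balance P? f g f≡g [] = refl
    balance P? f g f≡g (x ∷ xs) with balance P? f g f≡g xs | P? x
    ... | ih | yes _ = exchange (f x) (g x) ih
    ... | ih | no ¬p rewrite f≡g x ¬p =
      trans (+-assoc (g x) _ _) (trans (cong (g x +_) ih) (sym (+-assoc (g x) _ _)))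

  toggle-outside : ∀ V₀ v w → ¬ InN[ v ] w → toggle V₀ v w ≡ V₀ w
  toggle-outside V₀ v w w∉ =
    cong (λ b → if b then not (V₀ w) else V₀ w) (dec-false (inN[ v ]? w) w∉)

  total-decreases : ∀ {V₀ v} → Legal V₀ v → total (toggle V₀ v) < total V₀
  total-decreases {V₀} {v} (_ , σ<) =
    +-cancelʳ-< (σ V₀ v) _ _ (subst (_< total V₀ + σ V₀ v)
      (sym (balance inN[ v ]? (weight (toggle V₀ v)) (weight V₀)
        (λ w w∉ → cong (λ b → if b then 0 else 1) (toggle-outside V₀ v w w∉)) vertices))
      (+-monoʳ-< (total V₀) σ<))

  nimberAcc : ∀ V₀ → Acc _<_ (total V₀) → ℕ
  nimberAcc V₀ (acc rs) =
    mex (map (λ (v , l) → nimberAcc (toggle V₀ v) (rs (total-decreases l))) (legalMoves V₀))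

  nimber : (Vertex → Bool) → ℕ
  nimber V₀ = nimberAcc V₀ (<-wellFounded (total V₀))

  private
    nimberAcc-irrelevant : ∀ V₀ a b → nimberAcc V₀ a ≡ nimberAcc V₀ b
    nimberAcc-irrelevant V₀ (acc rs) (acc ss) =
      cong mex (map-cong
        (λ (v , l) → nimberAcc-irrelevant (toggle V₀ v) (rs (total-decreases l)) (ss (total-decreases l)))
        (legalMoves V₀))

    nimberAcc-mex : ∀ V₀ a →
      nimberAcc V₀ a ≡ mex (map (λ (v , _) → nimber (toggle V₀ v)) (legalMoves V₀))
    nimberAcc-mex V₀ (acc rs) = cong mex (map-cong
      (λ (v , l) → nimberAcc-irrelevant (toggle V₀ v) (rs (total-decreases l)) (<-wellFounded _))
      (legalMoves V₀))

  nimber-mex : ∀ V₀ → nimber V₀ ≡ mex (map (λ (v , _) → nimber (toggle V₀ v)) (legalMoves V₀))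
  nimber-mex V₀ = nimberAcc-mex V₀ (<-wellFounded (total V₀))

-- The recursive equation defining the nimber is Toggle.nimber-mex.
𝒢 : Position → ℕ
𝒢 ⟨ G , V₀ ⟩ = Toggle.nimber G V₀

-- The vertex v_{i,j} is represented by (i , c) with toℕ c = j - 1.
GridVertex : ℕ → Set
GridVertex m = Fin 2 × Fin m

GridEdge : ∀ {m} → GridVertex m → GridVertex m → Set
GridEdge (i , c) (i′ , c′) = (i ≡ 0F × i′ ≡ 1F × c ≡ c′) ⊎ (i ≡ i′ × toℕ c′ ≡ suc (toℕ c))

gridEdge? : ∀ {m} → Decidable (GridEdge {m})
gridEdge? (i , c) (i′ , c′) =
  ((i Fin.≟ 0F) ×-dec (i′ Fin.≟ 1F) ×-dec (c Fin.≟ c′)) ⊎-dec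
  ((i Fin.≟ i′) ×-dec (toℕ c′ ≟ suc (toℕ c)))

ℒ₂ : ℕ → Graph
ℒ₂ m = record
  { Vertex   = GridVertex m
  ; _≟ᵛ_     = ≡-dec Fin._≟_ Fin._≟_
  ; vertices = cartesianProduct (allFin 2) (allFin m)
  ; complete = λ (i , c) → ∈-cartesianProduct⁺ (∈-allFin i) (∈-allFin c)
  ; unique   = cartesianProduct⁺ (allFin⁺ 2) (allFin⁺ m)
  ; Adj      = λ v w → GridEdge v w ⊎ GridEdge w v
  ; adj?     = λ v w → gridEdge? v w ⊎-dec gridEdge? w v
  ; adj-sym  = swap
  ; loopless = λ v → [ no-loop v , no-loop v ]
  }
  where
  no-loop : ∀ v → ¬ GridEdge v v
  no-loop v (inj₁ (refl , () , _))
  no-loop v (inj₂ (_ , c≡1+c)) = 1+n≢n (sym c≡1+c)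

-- The 2 × m grid in which exactly the listed vertices have weight 0, where the
-- pair (i , j) stands for v_{i,j}, with j starting at 1.
gridPosition : ∀ m → List (ℕ × ℕ) → Position
gridPosition m zeros = ⟨ ℒ₂ m , (λ (i , c) → does ((toℕ i , suc (toℕ c)) ∈? zeros)) ⟩
  where open DecMembership (≡-dec _≟_ _≟_) using (_∈?_)

-- Only meant for m ≥ 3.
ℋ : ℕ → Position
ℋ 3 = gridPosition 3 ((0 , 1) ∷ (0 , 3) ∷ (1 , 1) ∷ (1 , 3) ∷ [])
ℋ m = gridPosition m ((0 , 1) ∷ (0 , m) ∷ (1 , 1) ∷ (1 , 2) ∷ (1 , m ∸ 1) ∷ (1 , m) ∷ [])

-- Only meant for m ≥ 3.
𝒟 : ℕ → Position
𝒟 m = gridPosition m ((0 , 1) ∷ (0 , m ∸ 1) ∷ (0 , m) ∷ (1 , 1) ∷ (1 , 2) ∷ (1 , m) ∷ [])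

-- The list lo , lo + 1 , … , hi, empty when hi < lo.
[_⋯_] : ℕ → ℕ → List ℕ
[ lo ⋯ hi ] = map (lo +_) (upTo (suc hi ∸ lo))

{-# OPTIONS --safe #-}
-- A column is a separator when both of its cells have weight 0 and it can
-- never change again. The two sides of a separator then play independently, so
-- by Sprague–Grundy the nimber of the position is the ⊕ of their nimbers.
-- Persistence rests on one count: a closed neighbourhood has at most four
-- vertices, so a move whose neighbourhood contains two zeros is illegal.
--
-- In 𝒟 m the legal moves are exactly v_{0,j} and v_{1,j} with 3 ≤ j ≤ m − 2. The
-- move v_{0,j} turns column j into a separator with 𝒟 j on its left and an
-- upside-down ℋ (m + 1 − j) on its right; the half turn of the grid, which fixes
-- 𝒟 m, carries v_{1,j} to v_{0,m+1−j}.

module Submission where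

open import Defs
open import Data.Bool using (Bool; true; false; not; _∨_; if_then_else_)
open import Data.Bool.Properties using (¬-not; ∨-identityʳ)
open import Data.Fin using (Fin; toℕ; fromℕ<; opposite; inject≤; cast; _↑ʳ_)
open import Data.Fin.Patterns using (0F; 1F)
import Data.Fin.Properties as Fin
open import Data.List using (List; []; _∷_; _++_; map; length; mapMaybe)
open import Data.List.Membership.Propositional using (_∈_; _∉_)
open import Data.List.Membership.Propositional.Properties using (∈-∃++; ∈-map⁺; ∈-map⁻; ∈-filter⁺; ∈-filter⁻; ∈-upTo⁺; ∈-upTo⁻)
open import Data.List.Membership.Propositional.Properties.WithK using (unique∧set⇒bag)
open import Data.List.Properties using (length-++; length-map; map-++; map-cong; map-∘)
open import Data.List.Relation.Binary.BagAndSetEquality using (∼bag⇒↭)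
open import Data.List.Relation.Binary.Permutation.Propositional using (_↭_; ↭-refl; ↭-trans; prep)
import Data.List.Relation.Binary.Permutation.Propositional.Properties as Perm
open import Data.List.Relation.Binary.Subset.Propositional using (_⊆_)
open import Data.List.Relation.Unary.All using (All; []; _∷_)
import Data.List.Relation.Unary.All as All
open import Data.List.Relation.Unary.AllPairs using ([]; _∷_)
open import Data.List.Relation.Unary.Any using (here; there)
open import Data.List.Relation.Unary.Unique.Propositional using (Unique)
import Data.List.Relation.Unary.Unique.Propositional.Properties as Unique
import Data.Maybe as Maybe
open import Data.Nat hiding (_≟_)
import Data.Nat as ℕ
open import Data.Nat.DivMod
open import Data.Nat.Induction using (<-wellFounded)
open import Data.Nat.ListAction using (sum)
open import Data.Nat.ListAction.Properties using (sum-↭; sum-++)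
open import Data.Nat.Properties hiding (_≟_)
open import Data.Product using (∃; ∃₂; _×_; _,_; proj₁; proj₂)
open import Data.Sum using (_⊎_; inj₁; inj₂; [_,_]) renaming (map to map-⊎)
open import Function using (_∘_; id; _⇔_; mk⇔; module Equivalence)
open import Induction.WellFounded using (Acc; acc)
open import Relation.Binary.Definitions using (tri<; tri≈; tri>)
open import Relation.Binary.PropositionalEquality hiding ([_])
open import Relation.Nullary using (¬_; Dec; yes; no; does; contradiction; _⊎-dec_)
open import Relation.Nullary.Decidable using (does-⇔; dec⇒maybe; dec-true; dec-false)

-- Minimal excludants and bitwise exclusive or

-- A separator is not a fixed pattern. The zero guarding it can be turned into a one by a legal move
-- two columns away from the separator. But that zero was then the only zero near the move, so the
-- move turns its own column to zero and this column takes over the protection. The invariant is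
-- therefore a recursive chain of zero columns. It is defined for one side only; the half turn
-- carries it to the other.
--
-- The exceptional shape of `ℋ 3` has the same origin. For j = m - 2 the move in row 0 flips
-- v_{0,m-1}, a zero of `𝒟 m`, into a one. The cell that guards the right side for smaller j is then
-- missing, and the zero last column protects the separator instead.

mex-unique : ∀ {xs n} → n ∉ xs → (∀ {j} → j < n → j ∈ xs) → mex xs ≡ n
mex-unique {xs} {n} n∉ below with <-cmp (mex xs) n
... | tri< mex<n _ _ = contradiction (below mex<n) (mex-∉ xs)
... | tri≈ _ mex≡n _ = mex≡n
... | tri> _ _ n<mex = contradiction (mex-least xs n<mex) n∉

/2-bound : ∀ {f} m → m ≤ suc f → m / 2 ≤ f
/2-bound zero _ = z≤n
/2-bound m@(suc _) m≤ = s≤s⁻¹ (≤-trans (m/n<m m 2 (s≤s (s≤s z≤n))) m≤)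

bits-injective : ∀ {m n} → m % 2 ≡ n % 2 → m / 2 ≡ n / 2 → m ≡ n
bits-injective {m} {n} %≡ /≡ = begin
  m                    ≡⟨ m≡m%n+[m/n]*n m 2 ⟩
  m % 2 + (m / 2) * 2  ≡⟨ cong₂ (λ b q → b + q * 2) %≡ /≡ ⟩
  n % 2 + (n / 2) * 2  ≡⟨ m≡m%n+[m/n]*n n 2 ⟨
  n                    ∎
  where open ≡-Reasoning

bit-cancelʳ : ∀ {a b c} → a < 2 → b < 2 → c < 2 → (a + c) % 2 ≡ (b + c) % 2 → a ≡ b
bit-cancelʳ {0} {0} _ _ _ _ = refl
bit-cancelʳ {1} {1} _ _ _ _ = refl
bit-cancelʳ {0} {1} {0} _ _ _ ()
bit-cancelʳ {0} {1} {1} _ _ _ ()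
bit-cancelʳ {1} {0} {0} _ _ _ ()
bit-cancelʳ {1} {0} {1} _ _ _ ()
bit-cancelʳ {suc (suc _)} (s≤s (s≤s ())) _ _ _
bit-cancelʳ {_} {suc (suc _)} _ (s≤s (s≤s ())) _ _
bit-cancelʳ {_} {_} {suc (suc _)} _ _ (s≤s (s≤s ())) _

bit-twice : ∀ {a b} → a < 2 → b < 2 → ((a + b) % 2 + b) % 2 ≡ a
bit-twice {0} {0} _ _ = refl
bit-twice {0} {1} _ _ = refl
bit-twice {1} {0} _ _ = refl
bit-twice {1} {1} _ _ = refl
bit-twice {suc (suc _)} (s≤s (s≤s ())) _
bit-twice {_} {suc (suc _)} _ (s≤s (s≤s ()))

xorBits-comm : ∀ f m n → xorBits f m n ≡ xorBits f n m
xorBits-comm zero m n = refl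
xorBits-comm (suc f) m n =
  cong₂ (λ s x → s % 2 + 2 * x) (+-comm (m % 2) (n % 2)) (xorBits-comm f (m / 2) (n / 2))

⊕-comm : ∀ m n → m ⊕ n ≡ n ⊕ m
⊕-comm m n = trans (xorBits-comm (m + n) m n) (cong (λ f → xorBits f n m) (+-comm m n))

-- Last bits cancel modulo 2 and halves cancel by recursion. `f` bounds `m` and `n`, which makes the
-- recursion on halves structural.
⊕-cancelʳ-bounded : ∀ f {m n} p → m ≤ f → n ≤ f → m ⊕ p ≡ n ⊕ p → m ≡ n
⊕-cancelʳ-bounded zero p z≤n z≤n _ = refl
⊕-cancelʳ-bounded (suc f) {m} {n} p m≤ n≤ eq = bits-injective
  (bit-cancelʳ (m%n<n m 2) (m%n<n n 2) (m%n<n p 2)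
    (trans (sym (⊕-%2 m p)) (trans (cong (_% 2) eq) (⊕-%2 n p))))
  (⊕-cancelʳ-bounded f (p / 2) (/2-bound m m≤) (/2-bound n n≤)
    (trans (sym (⊕-/2 m p)) (trans (cong (_/ 2) eq) (⊕-/2 n p))))

⊕-cancelʳ : ∀ {m n} p → m ⊕ p ≡ n ⊕ p → m ≡ n
⊕-cancelʳ {m} {n} p = ⊕-cancelʳ-bounded (m ⊔ n) p (m≤m⊔n m n) (m≤n⊔m m n)

-- The summand k with k ⊕ n ≡ j, computed from its half q.
⊕-solution : ∀ q n j → q ⊕ n / 2 ≡ j / 2 → ((j % 2 + n % 2) % 2 + q * 2) ⊕ n ≡ j
⊕-solution q n j eq = bits-injective
  (begin
    (k ⊕ n) % 2          ≡⟨ ⊕-%2 k n ⟩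
    (k % 2 + n % 2) % 2  ≡⟨ cong (λ x → (x + n % 2) % 2) k%2 ⟩
    (b + n % 2) % 2      ≡⟨ bit-twice (m%n<n j 2) (m%n<n n 2) ⟩
    j % 2                ∎)
  (trans (⊕-/2 k n) (trans (cong (_⊕ n / 2) k/2) eq))
  where
  open ≡-Reasoning
  b k : ℕ
  b = (j % 2 + n % 2) % 2
  k = b + q * 2
  k%2 : k % 2 ≡ b
  k%2 = trans ([m+kn]%n≡m%n b q 2) (m%n%n≡m%n (j % 2 + n % 2) 2)
  k/2 : k / 2 ≡ q
  k/2 = *-cancelʳ-≡ (k / 2) q 2 (+-cancelˡ-≡ (k % 2) _ _
          (trans (sym (m≡m%n+[m/n]*n k 2)) (cong (_+ q * 2) (sym k%2))))

bit+double< : ∀ {b q} m → b < 2 → q < m / 2 → b + q * 2 < m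
bit+double< {b} {q} m b<2 q<m/2 = begin-strict
  b + q * 2            <⟨ +-monoˡ-< (q * 2) b<2 ⟩
  suc q * 2            ≤⟨ *-monoˡ-≤ 2 q<m/2 ⟩
  (m / 2) * 2          ≤⟨ m/n*n≤m m 2 ⟩
  m                    ∎
  where open ≤-Reasoning

lower-bit< : ∀ m {b} → b < m % 2 → b + (m / 2) * 2 < m
lower-bit< m {b} b< = subst (b + (m / 2) * 2 <_) (sym (m≡m%n+[m/n]*n m 2)) (+-monoˡ-< _ b<)

-- The hypothesis forces `i` to be 0 and exactly one of `a`, `b` to be 1; that bit is the one that
-- can be lowered.
bit<sum : ∀ {i a b} → a < 2 → b < 2 → i < (a + b) % 2 →
  (i + b) % 2 < a ⊎ (i + a) % 2 < b
bit<sum {0} {0} {1} _ _ _ = inj₂ (s≤s z≤n)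
bit<sum {0} {1} {0} _ _ _ = inj₁ (s≤s z≤n)
bit<sum {_} {0} {0} _ _ ()
bit<sum {_} {1} {1} _ _ ()
bit<sum {suc _} {0} {1} _ _ (s≤s ())
bit<sum {suc _} {1} {0} _ _ (s≤s ())
bit<sum {_} {suc (suc _)} (s≤s (s≤s ())) _ _
bit<sum {_} {_} {suc (suc _)} _ (s≤s (s≤s ())) _

-- The arithmetic behind Sprague-Grundy. If `j` already differs from `m ⊕ n` after halving, a half
-- is lowered by recursion and the last bit is then chosen freely. Otherwise the halves agree, the
-- drop is in the last bit, and one summand loses its own last bit.
⊕-option-bounded : ∀ f m n j → m ≤ f → n ≤ f → j < m ⊕ n →
  (∃ λ m′ → m′ < m × m′ ⊕ n ≡ j) ⊎ (∃ λ n′ → n′ < n × n′ ⊕ m ≡ j)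
⊕-option-bounded zero zero zero j _ _ ()
⊕-option-bounded (suc f) m n j m≤ n≤ j< with m≤n⇒m<n∨m≡n j/2≤
  where
  j/2≤ : j / 2 ≤ m / 2 ⊕ n / 2
  j/2≤ = subst (j / 2 ≤_) (⊕-/2 m n) (/-monoˡ-≤ 2 (<⇒≤ j<))
... | inj₁ j/2< with ⊕-option-bounded f (m / 2) (n / 2) (j / 2) (/2-bound m m≤) (/2-bound n n≤) j/2<
...   | inj₁ (q , q< , eq) = inj₁ (_ , bit+double< m (m%n<n (j % 2 + n % 2) 2) q< , ⊕-solution q n j eq)
...   | inj₂ (q , q< , eq) = inj₂ (_ , bit+double< n (m%n<n (j % 2 + m % 2) 2) q< , ⊕-solution q m j eq)
⊕-option-bounded (suc f) m n j m≤ n≤ j< | inj₂ j/2≡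
  with bit<sum (m%n<n m 2) (m%n<n n 2) j%2<
  where
  open ≤-Reasoning
  q : ℕ
  q = j / 2
  j%2< : j % 2 < (m % 2 + n % 2) % 2
  j%2< = +-cancelʳ-< (q * 2) _ _ (begin-strict
    j % 2 + q * 2                        ≡⟨ m≡m%n+[m/n]*n j 2 ⟨
    j                                    <⟨ j< ⟩
    m ⊕ n                                ≡⟨ m≡m%n+[m/n]*n (m ⊕ n) 2 ⟩
    (m ⊕ n) % 2 + ((m ⊕ n) / 2) * 2      ≡⟨ cong₂ (λ b x → b + x * 2) (⊕-%2 m n) (trans (⊕-/2 m n) (sym j/2≡)) ⟩
    (m % 2 + n % 2) % 2 + q * 2          ∎)
... | inj₁ b< = inj₁ (_ , lower-bit< m b< , ⊕-solution (m / 2) n j (sym j/2≡))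
... | inj₂ b< = inj₂ (_ , lower-bit< n b< , ⊕-solution (n / 2) m j (trans (⊕-comm (n / 2) (m / 2)) (sym j/2≡)))

⊕-option : ∀ m n {j} → j < m ⊕ n →
  (∃ λ m′ → m′ < m × m′ ⊕ n ≡ j) ⊎ (∃ λ n′ → n′ < n × n′ ⊕ m ≡ j)
⊕-option m n = ⊕-option-bounded (m ⊔ n) m n _ (m≤m⊔n m n) (m≤n⊔m m n)

-- Toggle on arbitrary graphs

module _ {A : Set} where

  -- Allows a sum over a neighbourhood to be split into a few exhibited cells and an unnamed rest.
  unique-⊆-split : ∀ {xs zs : List A} → Unique zs → zs ⊆ xs → ∃ λ ys → xs ↭ zs ++ ys
  unique-⊆-split {xs} [] _ = xs , ↭-refl
  unique-⊆-split {xs} {z ∷ zs} (z∉ ∷ u) sub with ∈-∃++ (sub (here refl))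
  ... | as , bs , refl with unique-⊆-split {as ++ bs} u sub′
    where
    sub′ : zs ⊆ as ++ bs
    sub′ {x} x∈ with Perm.∈-resp-↭ (Perm.shift z as bs) (sub (there x∈))
    ... | here refl = contradiction refl (All.lookup z∉ x∈)
    ... | there x∈′ = x∈′
  ...   | ys , p = ys , ↭-trans (Perm.shift z as bs) (prep z p)

  unique-⊆-length : ∀ {xs zs : List A} → Unique zs → zs ⊆ xs → length zs ≤ length xs
  unique-⊆-length {xs} {zs} u sub with unique-⊆-split u sub
  ... | ys , p = subst (length zs ≤_) (sym (trans (Perm.↭-length p) (length-++ zs))) (m≤m+n _ _)

  sum-map-↭ : ∀ (f : A → ℕ) {xs} ys {zs} → xs ↭ ys ++ zs → sum (map f xs) ≡ sum (map f ys) + sum (map f zs)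
  sum-map-↭ f ys {zs} p = trans (sum-↭ (Perm.map⁺ f p)) (trans (cong sum (map-++ f ys zs)) (sum-++ (map f ys) (map f zs)))

  sum-const : ∀ {c} {f : A → ℕ} {zs} → All (λ z → f z ≡ c) zs → sum (map f zs) ≡ length zs * c
  sum-const [] = refl
  sum-const (eq ∷ eqs) = cong₂ _+_ eq (sum-const eqs)

  sum≤length : ∀ {f : A → ℕ} → (∀ x → f x ≤ 1) → ∀ xs → sum (map f xs) ≤ length xs
  sum≤length f≤1 [] = z≤n
  sum≤length f≤1 (x ∷ xs) = +-mono-≤ (f≤1 x) (sum≤length f≤1 xs)

  -- The common form of both legality criteria, for `length xs ≤ 4`. Two zeros before the move give
  -- a sum of at most 2 before and at least 2 after. Three ones, with the roles of `f` and `g`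
  -- exchanged, give at most 1 after and at least 3 before.
  sum-majority : ∀ {f g : A → ℕ} {xs zs} → Unique zs → zs ⊆ xs →
    All (λ z → f z ≡ 0) zs → All (λ z → g z ≡ 1) zs → (∀ x → f x ≤ 1) →
    sum (map f xs) + length zs ≤ length xs × length zs ≤ sum (map g xs)
  sum-majority {f} {g} {xs} {zs} u sub f≡0 g≡1 f≤1 with unique-⊆-split u sub
  ... | ys , p = fs , gs
    where
    open ≤-Reasoning
    fs : sum (map f xs) + length zs ≤ length xs
    fs = begin
      sum (map f xs) + length zs                     ≡⟨ cong (_+ length zs) (sum-map-↭ f zs p) ⟩
      sum (map f zs) + sum (map f ys) + length zs    ≡⟨ cong (λ s → s + sum (map f ys) + length zs) (trans (sum-const f≡0) (*-zeroʳ (length zs))) ⟩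
      sum (map f ys) + length zs                     ≤⟨ +-monoˡ-≤ (length zs) (sum≤length f≤1 ys) ⟩
      length ys + length zs                          ≡⟨ +-comm (length ys) (length zs) ⟩
      length zs + length ys                          ≡⟨ trans (Perm.↭-length p) (length-++ zs) ⟨
      length xs                                      ∎
    gs : length zs ≤ sum (map g xs)
    gs = begin
      length zs                          ≡⟨ trans (sum-const g≡1) (*-identityʳ (length zs)) ⟨
      sum (map g zs)                     ≤⟨ m≤m+n _ _ ⟩
      sum (map g zs) + sum (map g ys)    ≡⟨ sum-map-↭ g zs p ⟨
      sum (map g xs)                     ∎

module _ (G : Graph) where
  open Graph G
  open Toggle G

  ∈-N⁺ : ∀ {v w} → InN[ v ] w → w ∈ N[ v ]
  ∈-N⁺ {v} {w} w∈ = ∈-filter⁺ inN[ v ]? (complete w) w∈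

  ∈-N⁻ : ∀ {v w} → w ∈ N[ v ] → InN[ v ] w
  ∈-N⁻ {v} w∈ = proj₂ (∈-filter⁻ inN[ v ]? {xs = vertices} w∈)

  N-unique : ∀ v → Unique N[ v ]
  N-unique v = Unique.filter⁺ inN[ v ]? unique

  toggle-inside : ∀ V₀ v w → InN[ v ] w → toggle V₀ v w ≡ not (V₀ w)
  toggle-inside V₀ v w w∈ = cong (λ b → if b then not (V₀ w) else V₀ w) (dec-true (inN[ v ]? w) w∈)

  weight≤1 : ∀ V₀ v → weight V₀ v ≤ 1
  weight≤1 V₀ v with V₀ v
  ... | true  = z≤n
  ... | false = s≤s z≤n

  legal⇒false : ∀ V₀ {v} → Legal V₀ v → V₀ v ≡ false
  legal⇒false V₀ {v} (w≡1 , _) = weight≡1⇒false (V₀ v) w≡1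
    where
    weight≡1⇒false : ∀ b → (if b then 0 else 1) ≡ 1 → b ≡ false
    weight≡1⇒false false _ = refl

  weight-true : ∀ V₀ {v} → V₀ v ≡ true → weight V₀ v ≡ 0
  weight-true _ = cong (λ b → if b then 0 else 1)

  weight-false : ∀ V₀ {v} → V₀ v ≡ false → weight V₀ v ≡ 1
  weight-false _ = cong (λ b → if b then 0 else 1)

  toggled-weight-true : ∀ V₀ {v w} → InN[ v ] w → V₀ w ≡ true → weight (toggle V₀ v) w ≡ 1
  toggled-weight-true V₀ {v} {w} w∈ eq = weight-false (toggle V₀ v) (trans (toggle-inside V₀ v w w∈) (cong not eq))

  toggled-weight-false : ∀ V₀ {v w} → InN[ v ] w → V₀ w ≡ false → weight (toggle V₀ v) w ≡ 0
  toggled-weight-false V₀ {v} {w} w∈ eq = weight-true (toggle V₀ v) (trans (toggle-inside V₀ v w w∈) (cong not eq))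

  two-zeros⇒illegal : ∀ {V₀ v x y} → length N[ v ] ≤ 4 → x ≢ y → InN[ v ] x → InN[ v ] y →
    V₀ x ≡ true → V₀ y ≡ true → ¬ Legal V₀ v
  two-zeros⇒illegal {V₀} {v} {x} {y} N≤4 x≢y x∈ y∈ x0 y0 (_ , σ<) =
    <⇒≱ σ< (≤-trans (+-cancelʳ-≤ 2 _ 2 (≤-trans (proj₁ bounds) N≤4)) (proj₂ bounds))
    where
    bounds : σ V₀ v + 2 ≤ length N[ v ] × 2 ≤ σ (toggle V₀ v) v
    bounds = sum-majority {f = weight V₀} {g = weight (toggle V₀ v)} {xs = N[ v ]} {zs = x ∷ y ∷ []} ((x≢y ∷ []) ∷ [] ∷ [])
      (λ { (here refl) → ∈-N⁺ x∈ ; (there (here refl)) → ∈-N⁺ y∈ })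
      (weight-true V₀ x0 ∷ weight-true V₀ y0 ∷ [])
      (toggled-weight-true V₀ x∈ x0 ∷ toggled-weight-true V₀ y∈ y0 ∷ [])
      (weight≤1 V₀)

  three-ones⇒legal : ∀ {V₀ v x y} → length N[ v ] ≤ 4 → v ≢ x → v ≢ y → x ≢ y → InN[ v ] x → InN[ v ] y →
    V₀ v ≡ false → V₀ x ≡ false → V₀ y ≡ false → Legal V₀ v
  three-ones⇒legal {V₀} {v} {x} {y} N≤4 v≢x v≢y x≢y x∈ y∈ v1 x1 y1 =
    weight-false V₀ v1 ,
    ≤-trans (s≤s (+-cancelʳ-≤ 3 _ 1 (≤-trans (proj₁ bounds) N≤4))) (≤-trans (s≤s (s≤s z≤n)) (proj₂ bounds))
    where
    bounds : σ (toggle V₀ v) v + 3 ≤ length N[ v ] × 3 ≤ σ V₀ v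
    bounds = sum-majority {f = weight (toggle V₀ v)} {g = weight V₀} {xs = N[ v ]} {zs = v ∷ x ∷ y ∷ []} ((v≢x ∷ v≢y ∷ []) ∷ (x≢y ∷ []) ∷ [] ∷ [])
      (λ { (here refl) → ∈-N⁺ (inj₁ refl) ; (there (here refl)) → ∈-N⁺ x∈ ; (there (there (here refl))) → ∈-N⁺ y∈ })
      (toggled-weight-false V₀ (inj₁ refl) v1 ∷ toggled-weight-false V₀ x∈ x1 ∷ toggled-weight-false V₀ y∈ y1 ∷ [])
      (weight-false V₀ v1 ∷ weight-false V₀ x1 ∷ weight-false V₀ y1 ∷ [])
      (weight≤1 (toggle V₀ v))

  -- The list stores the proof produced by `legal?`, which need not be the given one; hence the
  -- existential.
  legal-∈ : ∀ {V₀ v} → Legal V₀ v → ∃ λ l → (v , l) ∈ legalMoves V₀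
  legal-∈ {V₀} {v} legal = search (complete v)
    where
    search : ∀ {xs} → v ∈ xs →
      ∃ λ l → (v , l) ∈ mapMaybe (λ v → Maybe.map (v ,_) (dec⇒maybe (legal? V₀ v))) xs
    search (here refl) with legal? V₀ v
    ... | yes l = l , here refl
    ... | no ¬l = contradiction legal ¬l
    search {x ∷ _} (there v∈) with legal? V₀ x | search v∈
    ... | yes _ | l , p = l , there p
    ... | no  _ | l , p = l , p

  private
    options : (Vertex → Bool) → List ℕ
    options V₀ = map (λ (v , _) → nimber (toggle V₀ v)) (legalMoves V₀)

    ∈-options⁺ : ∀ {V₀ v} → Legal V₀ v → nimber (toggle V₀ v) ∈ options V₀
    ∈-options⁺ l = ∈-map⁺ _ (proj₂ (legal-∈ l))

    ∈-options⁻ : ∀ {V₀ j} → j ∈ options V₀ → ∃ λ v → Legal V₀ v × nimber (toggle V₀ v) ≡ j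
    ∈-options⁻ {V₀} j∈ with ∈-map⁻ (λ (v , _) → nimber (toggle V₀ v)) {xs = legalMoves V₀} j∈
    ... | (v , l) , _ , eq = v , l , sym eq

  nimber-move≢ : ∀ {V₀ v} → Legal V₀ v → nimber (toggle V₀ v) ≢ nimber V₀
  nimber-move≢ {V₀} l eq = mex-∉ (options V₀) (subst (_∈ options V₀) (trans eq (nimber-mex V₀)) (∈-options⁺ l))

  nimber-moves : ∀ {V₀ j} → j < nimber V₀ → ∃ λ v → Legal V₀ v × nimber (toggle V₀ v) ≡ j
  nimber-moves {V₀} {j} j< = ∈-options⁻ (mex-least (options V₀) (subst (j <_) (nimber-mex V₀) j<))

  -- Frees later arguments from the list of moves: neither the order nor the repetition of options
  -- matters, so different moves may share a value.
  nimber-unique : ∀ {V₀ n} → (∀ {v} → Legal V₀ v → nimber (toggle V₀ v) ≢ n) →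
    (∀ {j} → j < n → ∃ λ v → Legal V₀ v × nimber (toggle V₀ v) ≡ j) → nimber V₀ ≡ n
  nimber-unique {V₀} avoid attain = trans (nimber-mex V₀) (mex-unique
    (λ n∈ → let _ , l , eq = ∈-options⁻ n∈ in avoid l eq)
    (λ j< → let _ , l , eq = attain j< in subst (_∈ options V₀) eq (∈-options⁺ l)))

-- Required at a single vertex, because the embedding of one side of a separator can fail it on the
-- separator column, whose cells lose their neighbours beyond it.
record PreservesN (A G : Graph) (φ : Graph.Vertex A → Graph.Vertex G) (a : Graph.Vertex A) : Set where
  private
    module A = Graph A
    module G = Graph G
  field
    into : ∀ {w} → A.InN[ a ] w → G.InN[ φ a ] (φ w)
    onto : ∀ {x} → G.InN[ φ a ] x → ∃ λ w → A.InN[ a ] w × φ w ≡ x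

module _ (A G : Graph) (φ : Graph.Vertex A → Graph.Vertex G)
         (φ-injective : ∀ {v w} → φ v ≡ φ w → v ≡ w)
         (V : Graph.Vertex G → Bool) (W : Graph.Vertex A → Bool)
         {a : Graph.Vertex A} (local : PreservesN A G φ a) (W≗V : ∀ w → W w ≡ V (φ w)) where
  private
    module A = Graph A
    module G = Graph G
    module TA = Toggle A
    module TG = Toggle G
  open PreservesN local

  -- A permutation instead of an equality, since the two graphs may list corresponding vertices in
  -- different orders; the half turn reverses the order.
  N-↭ : map φ A.N[ a ] ↭ G.N[ φ a ]
  N-↭ = ∼bag⇒↭ (unique∧set⇒bag (Unique.map⁺ φ-injective (N-unique A a)) (N-unique G (φ a))
    (mk⇔ (λ x∈ → let w , w∈ , eq = ∈-map⁻ φ x∈ in subst (_∈ G.N[ φ a ]) (sym eq) (∈-N⁺ G (into (∈-N⁻ A w∈))))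
         (λ x∈ → let w , w∈ , eq = onto (∈-N⁻ G x∈) in subst (_∈ map φ A.N[ a ]) eq (∈-map⁺ φ (∈-N⁺ A w∈)))))

  toggle-image : ∀ w → TA.toggle W a w ≡ TG.toggle V (φ a) (φ w)
  toggle-image w = cong₂ (λ d b → if d then not b else b)
    (does-⇔ (mk⇔ into reflect) (A.inN[ a ]? w) (G.inN[ φ a ]? (φ w))) (W≗V w)
    where
    reflect : G.InN[ φ a ] (φ w) → A.InN[ a ] w
    reflect w∈ with onto w∈
    ... | w′ , w′∈ , eq = subst (A.InN[ a ]) (φ-injective eq) w′∈

  σ-image : ∀ {V W} → (∀ w → W w ≡ V (φ w)) → TA.σ W a ≡ TG.σ V (φ a)
  σ-image {V} {W} eq = begin
    sum (map (TA.weight W) A.N[ a ])            ≡⟨ cong sum (map-cong (λ w → cong (λ b → if b then 0 else 1) (eq w)) A.N[ a ]) ⟩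
    sum (map (TG.weight V ∘ φ) A.N[ a ])        ≡⟨ cong sum (map-∘ A.N[ a ]) ⟩
    sum (map (TG.weight V) (map φ A.N[ a ]))    ≡⟨ sum-↭ (Perm.map⁺ (TG.weight V) N-↭) ⟩
    sum (map (TG.weight V) G.N[ φ a ])          ∎
    where open ≡-Reasoning

  legal-image : TA.Legal W a → TG.Legal V (φ a)
  legal-image (w , σ<) = trans (sym (cong (λ b → if b then 0 else 1) (W≗V a))) w ,
    subst₂ _<_ (σ-image toggle-image) (σ-image W≗V) σ<

  legal-preimage : TG.Legal V (φ a) → TA.Legal W a
  legal-preimage (w , σ<) = trans (cong (λ b → if b then 0 else 1) (W≗V a)) w ,
    subst₂ _<_ (sym (σ-image toggle-image)) (sym (σ-image W≗V)) σ<

module _ (G : Graph) (ρ : Graph.Vertex G → Graph.Vertex G) (ρ-involutive : ∀ v → ρ (ρ v) ≡ v)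
         (ρ-local : ∀ v → PreservesN G G ρ v) where
  open Graph G
  open Toggle G

  -- Pointwise agreement is what `toggle-image` carries across a move, so the induction on total
  -- weight is stated for any such `W` instead of `V ∘ ρ` itself.
  nimber-symmetric : ∀ V W → (∀ w → W w ≡ V (ρ w)) → nimber V ≡ nimber W
  nimber-symmetric V W W≗V = go V W W≗V (<-wellFounded (total V))
    where
    ρ-injective : ∀ {v w} → ρ v ≡ ρ w → v ≡ w
    ρ-injective {v} {w} eq = trans (sym (ρ-involutive v)) (trans (cong ρ eq) (ρ-involutive w))
    go : ∀ V W → (∀ w → W w ≡ V (ρ w)) → Acc _<_ (total V) → nimber V ≡ nimber W
    go V W W≗V (acc rs) = nimber-unique G {V} avoid attain
      where
      move : ∀ {v} → Legal V (ρ v) → nimber (toggle V (ρ v)) ≡ nimber (toggle W v)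
      move {v} l = go (toggle V (ρ v)) (toggle W v) (toggle-image G G ρ ρ-injective V W (ρ-local v) W≗V)
        (rs (total-decreases {V} l))
      avoid-ρ : ∀ v → Legal V (ρ v) → nimber (toggle V (ρ v)) ≢ nimber W
      avoid-ρ v l eq = nimber-move≢ G {W} {v} (legal-preimage G G ρ ρ-injective V W (ρ-local v) W≗V l)
        (trans (sym (move l)) eq)
      avoid : ∀ {v} → Legal V v → nimber (toggle V v) ≢ nimber W
      -- Every vertex has the form `ρ u`, with `u` its own image under the involution.
      avoid {v} = subst (λ u → Legal V u → nimber (toggle V u) ≢ nimber W) (ρ-involutive v) (avoid-ρ (ρ v))
      attain : ∀ {j} → j < nimber W → ∃ λ v → Legal V v × nimber (toggle V v) ≡ j
      attain j< =
        let v , l , eq = nimber-moves G {W} j<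
            l′ = legal-image G G ρ ρ-injective V W (ρ-local v) W≗V l
        in ρ v , l′ , trans (move l′) eq

-- Sprague-Grundy for two independent pieces of a position

module Gluing
  (G A B : Graph) (Inv : (Graph.Vertex G → Bool) → Set)
  (φ : Graph.Vertex A → Graph.Vertex G) (ψ : Graph.Vertex B → Graph.Vertex G)
  (φ-injective : ∀ {v w} → φ v ≡ φ w → v ≡ w) (ψ-injective : ∀ {v w} → ψ v ≡ ψ w → v ≡ w)
  (φ-local : ∀ {V a} → Inv V → V (φ a) ≡ false → PreservesN A G φ a)
  (ψ-local : ∀ {V b} → Inv V → V (ψ b) ≡ false → PreservesN B G ψ b)
  (Inv-toggle : ∀ {V v} → Inv V → Toggle.Legal G V v → Inv (Toggle.toggle G V v))
  (cover : ∀ {V v} → Inv V → Toggle.Legal G V v →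
    (∃ λ a → φ a ≡ v × (∀ b → ¬ Graph.InN[_] G v (ψ b))) ⊎
    (∃ λ b → ψ b ≡ v × (∀ a → ¬ Graph.InN[_] G v (φ a))))
  where
  private
    module TG = Toggle G
    module TA = Toggle A
    module TB = Toggle B

  -- Induction on total weight. If a move reached the claimed value, cancelling the untouched
  -- summand would give a move in one piece that preserves the nimber of that piece. Every smaller
  -- value is reached by lowering one summand, by `⊕-option`. The images of `φ` and `ψ` may overlap:
  -- it is enough that no legal move of one piece touches the image of the other.
  nimber-⊕ : ∀ {V Q R} → Inv V → (∀ a → Q a ≡ V (φ a)) → (∀ b → R b ≡ V (ψ b)) →
    TG.nimber V ≡ TA.nimber Q ⊕ TB.nimber R
  nimber-⊕ {V} {Q} {R} = go V Q R (<-wellFounded (TG.total V))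
    where
    go : ∀ V Q R → Acc _<_ (TG.total V) → Inv V → (∀ a → Q a ≡ V (φ a)) → (∀ b → R b ≡ V (ψ b)) →
      TG.nimber V ≡ TA.nimber Q ⊕ TB.nimber R
    go V Q R (acc rs) inv Q≗ R≗ = nimber-unique G {V} avoid attain
      where
      φ-move : ∀ {a} → TG.Legal V (φ a) → (∀ b → ¬ Graph.InN[_] G (φ a) (ψ b)) →
        TG.nimber (TG.toggle V (φ a)) ≡ TA.nimber (TA.toggle Q a) ⊕ TB.nimber R
      φ-move {a} l far = go (TG.toggle V (φ a)) (TA.toggle Q a) R (rs (TG.total-decreases {V} l)) (Inv-toggle {V} inv l)
        (toggle-image A G φ φ-injective V Q (φ-local {V} inv (legal⇒false G V l)) Q≗)
        (λ b → trans (R≗ b) (sym (TG.toggle-outside V (φ a) (ψ b) (far b))))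
      ψ-move : ∀ {b} → TG.Legal V (ψ b) → (∀ a → ¬ Graph.InN[_] G (ψ b) (φ a)) →
        TG.nimber (TG.toggle V (ψ b)) ≡ TA.nimber Q ⊕ TB.nimber (TB.toggle R b)
      ψ-move {b} l far = go (TG.toggle V (ψ b)) Q (TB.toggle R b) (rs (TG.total-decreases {V} l)) (Inv-toggle {V} inv l)
        (λ a → trans (Q≗ a) (sym (TG.toggle-outside V (ψ b) (φ a) (far a))))
        (toggle-image B G ψ ψ-injective V R (ψ-local {V} inv (legal⇒false G V l)) R≗)
      avoid : ∀ {v} → TG.Legal V v → TG.nimber (TG.toggle V v) ≢ TA.nimber Q ⊕ TB.nimber R
      avoid l eq with cover {V} inv l
      ... | inj₁ (a , refl , far) = nimber-move≢ A {Q} {a}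
        (legal-preimage A G φ φ-injective V Q (φ-local {V} inv (legal⇒false G V l)) Q≗ l)
        (⊕-cancelʳ (TB.nimber R) (trans (sym (φ-move l far)) eq))
      ... | inj₂ (b , refl , far) = nimber-move≢ B {R} {b}
        (legal-preimage B G ψ ψ-injective V R (ψ-local {V} inv (legal⇒false G V l)) R≗ l)
        (⊕-cancelʳ (TA.nimber Q) (trans (⊕-comm (TB.nimber (TB.toggle R b)) (TA.nimber Q)) (trans (sym (ψ-move l far)) (trans eq (⊕-comm (TA.nimber Q) (TB.nimber R))))))
      φ-attain : ∀ {a} → TA.Legal Q a → TG.Legal V (φ a) × (∀ b → ¬ Graph.InN[_] G (φ a) (ψ b))
      φ-attain {a} l with l′ ← legal-image A G φ φ-injective V Q (φ-local {V} inv (trans (sym (Q≗ a)) (legal⇒false A Q l))) Q≗ l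
        with cover {V} inv l′
      ... | inj₁ (_ , _ , far) = l′ , far
      -- A vertex lies in its own closed neighbourhood, so the move at `φ a` cannot be far from the
      -- image of `φ`.
      ... | inj₂ (_ , _ , far) = contradiction (inj₁ refl) (far a)
      ψ-attain : ∀ {b} → TB.Legal R b → TG.Legal V (ψ b) × (∀ a → ¬ Graph.InN[_] G (ψ b) (φ a))
      ψ-attain {b} l with l′ ← legal-image B G ψ ψ-injective V R (ψ-local {V} inv (trans (sym (R≗ b)) (legal⇒false B R l))) R≗ l
        with cover {V} inv l′
      ... | inj₁ (_ , _ , far) = contradiction (inj₁ refl) (far b)
      ... | inj₂ (_ , _ , far) = l′ , far
      attain : ∀ {j} → j < TA.nimber Q ⊕ TB.nimber R → ∃ λ v → TG.Legal V v × TG.nimber (TG.toggle V v) ≡ j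
      attain {j} j< = [ φ-case , ψ-case ] (⊕-option (TA.nimber Q) (TB.nimber R) j<)
        where
        φ-case : (∃ λ q → q < TA.nimber Q × q ⊕ TB.nimber R ≡ j) → ∃ λ v → TG.Legal V v × TG.nimber (TG.toggle V v) ≡ j
        φ-case (q , q< , eq) =
          let a , l , q≡ = nimber-moves A {Q} q<
              l′ , far = φ-attain l
          in φ a , l′ , trans (φ-move l′ far) (trans (cong (_⊕ TB.nimber R) q≡) eq)
        ψ-case : (∃ λ r → r < TB.nimber R × r ⊕ TA.nimber Q ≡ j) → ∃ λ v → TG.Legal V v × TG.nimber (TG.toggle V v) ≡ j
        ψ-case (r , r< , eq) =
          let b , l , r≡ = nimber-moves B {R} r<
              l′ , far = ψ-attain l
          in ψ b , l′ , trans (ψ-move l′ far) (trans (⊕-comm (TA.nimber Q) (TB.nimber (TB.toggle R b))) (trans (cong (_⊕ TA.nimber Q) r≡) eq))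

-- The grid ℒ₂ m

module _ {m : ℕ} where
  open Graph (ℒ₂ m)
  open Toggle (ℒ₂ m)

  Beside : Fin m → Fin m → Set
  Beside c d = toℕ d ≡ suc (toℕ c) ⊎ toℕ c ≡ suc (toℕ d)

  Near : GridVertex m → GridVertex m → Set
  Near (i , c) (i′ , c′) = c′ ≡ c ⊎ (i′ ≡ i × Beside c c′)

  near⇒inN : ∀ v w → Near v w → InN[ v ] w
  near⇒inN (0F , c) (0F , _) (inj₁ refl) = inj₁ refl
  near⇒inN (0F , c) (1F , _) (inj₁ refl) = inj₂ (inj₁ (inj₁ (refl , refl , refl)))
  near⇒inN (1F , c) (0F , _) (inj₁ refl) = inj₂ (inj₂ (inj₁ (refl , refl , refl)))
  near⇒inN (1F , c) (1F , _) (inj₁ refl) = inj₁ refl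
  near⇒inN _ _ (inj₂ (refl , inj₁ eq)) = inj₂ (inj₁ (inj₂ (refl , eq)))
  near⇒inN _ _ (inj₂ (refl , inj₂ eq)) = inj₂ (inj₂ (inj₂ (refl , eq)))

  inN⇒near : ∀ v w → InN[ v ] w → Near v w
  inN⇒near _ _ (inj₁ refl) = inj₁ refl
  inN⇒near _ _ (inj₂ (inj₁ (inj₁ (_ , _ , refl)))) = inj₁ refl
  inN⇒near _ _ (inj₂ (inj₁ (inj₂ (refl , eq)))) = inj₂ (refl , inj₁ eq)
  inN⇒near _ _ (inj₂ (inj₂ (inj₁ (_ , _ , refl)))) = inj₁ refl
  inN⇒near _ _ (inj₂ (inj₂ (inj₂ (refl , eq)))) = inj₂ (refl , inj₂ eq)

  -- With natural numbers as columns, one list of candidates serves the border too: a candidate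
  -- outside the grid, or the repetition caused by `pred 0`, does no harm to an upper bound.
  N-length : ∀ v → length N[ v ] ≤ 4
  N-length (i , c) = subst (_≤ 4) (length-map coord N[ i , c ])
    (unique-⊆-length {xs = (0F , toℕ c) ∷ (1F , toℕ c) ∷ (i , suc (toℕ c)) ∷ (i , pred (toℕ c)) ∷ []}
      (Unique.map⁺ coord-injective (N-unique (ℒ₂ m) (i , c))) enumerate)
    where
    coord : GridVertex m → Fin 2 × ℕ
    coord (j , d) = j , toℕ d
    coord-injective : ∀ {v w} → coord v ≡ coord w → v ≡ w
    coord-injective {_ , d} {_ , e} eq =
      cong₂ _,_ (cong proj₁ eq) (Fin.toℕ-injective (cong proj₂ eq))
    candidates : List (Fin 2 × ℕ)
    candidates = (0F , toℕ c) ∷ (1F , toℕ c) ∷ (i , suc (toℕ c)) ∷ (i , pred (toℕ c)) ∷ []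
    near∈ : ∀ w → Near (i , c) w → coord w ∈ candidates
    near∈ (0F , _) (inj₁ refl) = here refl
    near∈ (1F , _) (inj₁ refl) = there (here refl)
    near∈ _ (inj₂ (refl , inj₁ eq)) = there (there (here (cong (i ,_) eq)))
    near∈ _ (inj₂ (refl , inj₂ eq)) = there (there (there (here (cong (i ,_) (sym (cong pred eq))))))
    enumerate : ∀ {p} → p ∈ map coord N[ i , c ] → p ∈ candidates
    enumerate p∈ with ∈-map⁻ coord p∈
    ... | w , w∈ , refl = near∈ w (inN⇒near (i , c) w (∈-N⁻ (ℒ₂ m) w∈))

  two-near-zeros⇒illegal : ∀ V {v} x y → x ≢ y → Near v x → Near v y → V x ≡ true → V y ≡ true → ¬ Legal V v
  two-near-zeros⇒illegal V {v} x y x≢y x∈ y∈ =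
    two-zeros⇒illegal (ℒ₂ m) {V} (N-length v) x≢y (near⇒inN v x x∈) (near⇒inN v y y∈)

  -- A legal move has at most one zero in its neighbourhood, so next to the zero `x` every other
  -- cell there is a one and turns to zero. This is how new zero columns arise.
  legal⇒toggled-zero : ∀ V {v} x y → Legal V v → x ≢ y → Near v x → Near v y → V x ≡ true → toggle V v y ≡ true
  legal⇒toggled-zero V {v} x y l x≢y x∈ y∈ x0 = trans (toggle-inside (ℒ₂ m) V v y (near⇒inN v y y∈))
    (cong not (¬-not λ y0 → two-near-zeros⇒illegal V x y x≢y x∈ y∈ x0 y0 l))

  toggle-far : ∀ V v w → ¬ Near v w → toggle V v w ≡ V w
  toggle-far V v w ¬near = toggle-outside V v w (¬near ∘ inN⇒near v w)

  far-left : ∀ {i c i′ c′} → suc (toℕ c′) < toℕ c → ¬ Near (i , c) (i′ , c′)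
  far-left lt (inj₁ refl) = <-asym lt (n<1+n _)
  far-left lt (inj₂ (_ , inj₁ eq)) = <-asym (<-trans (n<1+n _) lt) (≤-reflexive (sym eq))
  far-left lt (inj₂ (_ , inj₂ eq)) = <⇒≢ lt (sym eq)

  far-right : ∀ {i c i′ c′} → suc (toℕ c) < toℕ c′ → ¬ Near (i , c) (i′ , c′)
  far-right lt (inj₁ refl) = <-asym lt (n<1+n _)
  far-right lt (inj₂ (_ , inj₁ eq)) = <⇒≢ lt (sym eq)
  far-right lt (inj₂ (_ , inj₂ eq)) = <-asym (<-trans (n<1+n _) lt) (≤-reflexive (sym eq))

  -- Vacuous when `k` is not a column of the grid. Thus the last column counts as `guarded` as soon
  -- as it is zero, whereas `skip` needs an actual column to supply zeros and carries a bound for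
  -- it.
  ZeroAt : (GridVertex m → Bool) → Fin 2 → ℕ → Set
  ZeroAt V i k = ∀ c → toℕ c ≡ k → V (i , c) ≡ true

  -- Column k is zero, and no sequence of moves in columns beyond k can change
  -- that: a zero in column k + 1 makes the moves in that column illegal, and so
  -- does a second zero column k + 2, which appears when the move next to the
  -- guarding zero turns it into a one.
  data Sealed (V : GridVertex m → Bool) (k : ℕ) : Set where
    guarded : (∀ i → ZeroAt V i k) → ∀ i → ZeroAt V i (suc k) → Sealed V k
    skip    : (∀ i → ZeroAt V i k) → suc (suc k) < m → Sealed V (suc (suc k)) → Sealed V k

  sealed⇒zero : ∀ {V k} → Sealed V k → ∀ i → ZeroAt V i k
  sealed⇒zero (guarded zs _ _) = zs
  sealed⇒zero (skip zs _ _)    = zs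

  sealed-cong : ∀ {V W k} → (∀ i c → k ≤ toℕ c → V (i , c) ≡ W (i , c)) → Sealed V k → Sealed W k
  sealed-cong V≗W (guarded zs i z) = guarded
    (λ i c eq → trans (sym (V≗W i c (≤-reflexive (sym eq)))) (zs i c eq))
    i (λ c eq → trans (sym (V≗W i c (≤-trans (n≤1+n _) (≤-reflexive (sym eq))))) (z c eq))
  sealed-cong V≗W (skip zs k< s) = skip
    (λ i c eq → trans (sym (V≗W i c (≤-reflexive (sym eq)))) (zs i c eq))
    k< (sealed-cong (λ i c k≤ → V≗W i c (≤-trans (n≤1+n _) (≤-trans (n≤1+n _) k≤))) s)

  column : ∀ {k} → k < m → ∃ λ (c : Fin m) → toℕ c ≡ k
  column k< = fromℕ< k< , Fin.toℕ-fromℕ< k<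

  -- The two zeros are, in the guarded case, the guard and the cell of column `k` in the row of the
  -- move (unless the move is at the guard itself); for `skip`, the cells on either side.
  sealed⇒illegal : ∀ V {k i c} → Sealed V k → toℕ c ≡ suc k → ¬ Legal V (i , c)
  sealed⇒illegal V {k} {i} {c} (guarded zs i₀ z) c≡ l with i Fin.≟ i₀
  ... | yes refl = contradiction (trans (sym (z c c≡)) (legal⇒false (ℒ₂ m) V l)) λ ()
  ... | no i≢i₀ with column (<-trans (n<1+n k) (subst (_< m) c≡ (Fin.toℕ<n c)))
  ...   | d , refl = two-near-zeros⇒illegal V (i₀ , c) (i , d) (i≢i₀ ∘ sym ∘ cong proj₁)
            (inj₁ refl) (inj₂ (refl , inj₂ c≡)) (z c c≡) (zs i d refl) l
  sealed⇒illegal V {k} {i} {c} (skip zs k+2< s) c≡ l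
    with column (<-trans (n<1+n k) (subst (_< m) c≡ (Fin.toℕ<n c))) | column k+2<
  ... | d , refl | e , e≡ = two-near-zeros⇒illegal V (i , d) (i , e)
          (λ eq → <⇒≢ (<-trans (n<1+n _) (n<1+n _)) (trans (cong (toℕ ∘ proj₂) eq) e≡))
          (inj₂ (refl , inj₂ c≡)) (inj₂ (refl , inj₁ (trans e≡ (cong suc (sym c≡)))))
          (zs i d refl) (sealed⇒zero s i e e≡) l

  sealed⇒beyond : ∀ V {k i c} → Sealed V k → k < toℕ c → Legal V (i , c) → suc k < toℕ c
  sealed⇒beyond V s k< l = ≤∧≢⇒< k< (λ eq → sealed⇒illegal V s (sym eq) l)

  toggle-zeroAt : ∀ V {i c k} → suc k < toℕ c → ∀ j → ZeroAt V j k → ZeroAt (toggle V (i , c)) j k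
  toggle-zeroAt V {i} {c} k< j z d refl = trans (toggle-far V (i , c) (j , d) (far-left k<)) (z d refl)

  toggle-sealed : ∀ V {k i c} → Sealed V k → k < toℕ c → Legal V (i , c) → Sealed (toggle V (i , c)) k
  toggle-sealed V {k} {i} {c} s k< l with sealed⇒beyond V s k< l
  toggle-sealed V {k} {i} {c} (skip zs k+2< s) k< l | k+1< =
    skip (λ j → toggle-zeroAt V k+1< j (zs j)) k+2< (toggle-sealed V s
      (≤∧≢⇒< k+1< λ eq → contradiction (trans (sym (sealed⇒zero s i c (sym eq))) (legal⇒false (ℒ₂ m) V l)) λ ()) l)
  toggle-sealed V {k} {i} {c} (guarded zs i₀ z) k< l | k+1< with toℕ c ℕ.≟ suc (suc k) | i Fin.≟ i₀
  ... | no c≢ | _ = guarded (λ j → toggle-zeroAt V k+1< j (zs j)) i₀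
                      (toggle-zeroAt V (≤∧≢⇒< k+1< (c≢ ∘ sym)) i₀ z)
  ... | yes c≡ | no i≢i₀ = guarded (λ j → toggle-zeroAt V k+1< j (zs j)) i₀
      (λ d d≡ → trans (toggle-far V (i , c) (i₀ , d)
        λ { (inj₁ refl) → <⇒≢ k+1< (sym d≡) ; (inj₂ (eq , _)) → i≢i₀ (sym eq) }) (z d d≡))
  -- The move flips the guard, its only nearby zero. Both cells of column `k + 2`, and the next cell
  -- in row `i` if the grid has one, turn to zero: column `k + 2` is now a guarded column.
  ... | yes c≡ | yes refl with column (<-trans k+1< (Fin.toℕ<n c))
  ...   | d , d≡ = skip (λ j → toggle-zeroAt V k+1< j (zs j)) (subst (_< m) c≡ (Fin.toℕ<n c))
      (guarded
        (λ j e e≡ → legal⇒toggled-zero V (i , d) (j , e) l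
          (λ eq → <⇒≢ (n<1+n (suc k)) (trans (sym d≡) (trans (cong (toℕ ∘ proj₂) eq) e≡)))
          d-near (inj₁ (Fin.toℕ-injective (trans e≡ (sym c≡)))) (z d d≡))
        i
        (λ e e≡ → legal⇒toggled-zero V (i , d) (i , e) l
          (λ eq → <⇒≢ (<-trans (n<1+n (suc k)) (n<1+n _)) (trans (sym d≡) (trans (cong (toℕ ∘ proj₂) eq) e≡)))
          d-near (inj₂ (refl , inj₁ (trans e≡ (cong suc (sym c≡))))) (z d d≡)))
    where
    d-near : Near (i , c) (i , d)
    d-near = inj₂ (refl , inj₂ (trans c≡ (cong suc (sym d≡))))

-- Row and column maps between grids, and the half turn

rowsCols : ∀ {a m} → (Fin 2 → Fin 2) → (Fin a → Fin m) → GridVertex a → GridVertex m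
rowsCols τ f (i , c) = τ i , f c

module _ {a m : ℕ} (τ : Fin 2 → Fin 2) (τ-involutive : ∀ i → τ (τ i) ≡ i) (f : Fin a → Fin m) where

  rowsCols-injective : (∀ {c d} → f c ≡ f d → c ≡ d) → ∀ {v w} → rowsCols τ f v ≡ rowsCols τ f w → v ≡ w
  rowsCols-injective f-injective {i , _} {j , _} eq = cong₂ _,_
    (trans (sym (τ-involutive i)) (trans (cong (τ ∘ proj₁) eq) (τ-involutive j)))
    (f-injective (cong proj₂ eq))

  rowsCols-preservesN : ∀ {i c} → (∀ {d} → Beside c d → Beside (f c) (f d)) →
    (∀ {e} → Beside (f c) e → ∃ λ d → Beside c d × f d ≡ e) →
    PreservesN (ℒ₂ a) (ℒ₂ m) (rowsCols τ f) (i , c)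
  rowsCols-preservesN {i} {c} into onto = record
    { into = λ {w} w∈ → near⇒inN (rowsCols τ f (i , c)) (rowsCols τ f w) (into′ w (inN⇒near (i , c) w w∈))
    ; onto = λ {x} x∈ → let w , near , eq = onto′ x (inN⇒near (rowsCols τ f (i , c)) x x∈)
                        in w , near⇒inN (i , c) w near , eq }
    where
    into′ : ∀ w → Near (i , c) w → Near (rowsCols τ f (i , c)) (rowsCols τ f w)
    into′ _ (inj₁ refl) = inj₁ refl
    into′ _ (inj₂ (refl , beside)) = inj₂ (refl , into beside)
    onto′ : ∀ x → Near (rowsCols τ f (i , c)) x → ∃ λ w → Near (i , c) w × rowsCols τ f w ≡ x
    onto′ (j , _) (inj₁ refl) = (τ j , c) , inj₁ refl , cong (_, f c) (τ-involutive j)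
    onto′ (_ , e) (inj₂ (refl , beside)) with onto beside
    ... | d , beside′ , refl = (i , d) , inj₂ (refl , beside′) , refl

opposite-+ : ∀ {m} (c : Fin m) → toℕ (opposite c) + suc (toℕ c) ≡ m
opposite-+ c = trans (cong (_+ suc (toℕ c)) (Fin.opposite-prop c)) (m∸n+n≡m (Fin.toℕ<n c))

opposite-injective : ∀ {m} {c d : Fin m} → opposite c ≡ opposite d → c ≡ d
opposite-injective {c = c} {d} eq =
  trans (sym (Fin.opposite-involutive c)) (trans (cong opposite eq) (Fin.opposite-involutive d))

opposite-next : ∀ {m} (c d : Fin m) → toℕ d ≡ suc (toℕ c) → toℕ (opposite c) ≡ suc (toℕ (opposite d))
opposite-next {m} c d eq = +-cancelʳ-≡ (suc (toℕ c)) _ _ (begin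
  toℕ (opposite c) + suc (toℕ c)        ≡⟨ opposite-+ c ⟩
  m                                     ≡⟨ opposite-+ d ⟨
  toℕ (opposite d) + suc (toℕ d)        ≡⟨ cong (λ x → toℕ (opposite d) + suc x) eq ⟩
  toℕ (opposite d) + suc (suc (toℕ c))  ≡⟨ +-suc (toℕ (opposite d)) (suc (toℕ c)) ⟩
  suc (toℕ (opposite d)) + suc (toℕ c)  ∎)
  where open ≡-Reasoning

opposite-beside : ∀ {m} {c d : Fin m} → Beside c d → Beside (opposite c) (opposite d)
opposite-beside {c = c} {d} (inj₁ eq) = inj₂ (opposite-next c d eq)
opposite-beside {c = c} {d} (inj₂ eq) = inj₁ (opposite-next d c eq)

ρ : ∀ {m} → GridVertex m → GridVertex m
ρ = rowsCols opposite opposite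

ρ-involutive : ∀ {m} (v : GridVertex m) → ρ (ρ v) ≡ v
ρ-involutive (i , c) = cong₂ _,_ (Fin.opposite-involutive i) (Fin.opposite-involutive c)

module _ {m : ℕ} where
  open Toggle (ℒ₂ m)

  ρ-injective : ∀ {v w : GridVertex m} → ρ v ≡ ρ w → v ≡ w
  ρ-injective {v} {w} = rowsCols-injective opposite Fin.opposite-involutive opposite opposite-injective {v} {w}

  ρ-preservesN : ∀ v → PreservesN (ℒ₂ m) (ℒ₂ m) ρ v
  ρ-preservesN (i , c) = rowsCols-preservesN opposite Fin.opposite-involutive opposite opposite-beside
    (λ {e} beside → opposite e ,
      subst (λ d → Beside d (opposite e)) (Fin.opposite-involutive c) (opposite-beside beside) ,
      Fin.opposite-involutive e)

  module _ (V W : GridVertex m → Bool) (W≗V : ∀ w → W w ≡ V (ρ w)) (v : GridVertex m) where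

    toggle-ρ : ∀ w → toggle W v w ≡ toggle V (ρ v) (ρ w)
    toggle-ρ = toggle-image (ℒ₂ m) (ℒ₂ m) ρ ρ-injective V W (ρ-preservesN v) W≗V

    legal-ρ⁻ : Legal V (ρ v) → Legal W v
    legal-ρ⁻ = legal-preimage (ℒ₂ m) (ℒ₂ m) ρ ρ-injective V W (ρ-preservesN v) W≗V

  nimber-ρ : ∀ V W → (∀ w → W w ≡ V (ρ w)) → nimber V ≡ nimber W
  nimber-ρ V W = nimber-symmetric (ℒ₂ m) ρ ρ-involutive ρ-preservesN V W

  -- k′ is the number of column k in the grid turned by the half turn ρ.
  Separates : ℕ → ℕ → (GridVertex m → Bool) → Set
  Separates k k′ V = Sealed V k × Sealed (V ∘ ρ) k′

  module _ {k k′ : ℕ} (m≡ : k + suc k′ ≡ m) where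

    opposite-≤ : ∀ (c : Fin m) → k′ ≤ toℕ c → toℕ (opposite c) ≤ k
    opposite-≤ c k′≤ = +-cancelʳ-≤ (suc k′) _ _ (begin
      toℕ (opposite c) + suc k′       ≤⟨ +-monoʳ-≤ (toℕ (opposite c)) (s≤s k′≤) ⟩
      toℕ (opposite c) + suc (toℕ c)  ≡⟨ trans (opposite-+ c) (sym m≡) ⟩
      k + suc k′                      ∎)
      where open ≤-Reasoning

    opposite-< : ∀ (c : Fin m) → toℕ c < k → k′ < toℕ (opposite c)
    opposite-< c c< = +-cancelʳ-≤ (suc (toℕ c)) _ _ (begin
      suc k′ + suc (toℕ c)            ≤⟨ +-monoʳ-≤ (suc k′) c< ⟩
      suc k′ + k                      ≡⟨ trans (+-comm (suc k′) k) (trans m≡ (sym (opposite-+ c))) ⟩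
      toℕ (opposite c) + suc (toℕ c)  ∎)
      where open ≤-Reasoning

    -- The right seal persists by `toggle-sealed`. The left one depends only on columns up to `k`,
    -- which a legal move beyond column `k + 1` does not reach. Moves on the left reduce to this
    -- case by the half turn.
    separates-toggle-right : ∀ V {i c} → Separates k k′ V → k < toℕ c → Legal V (i , c) →
      Separates k k′ (toggle V (i , c))
    separates-toggle-right V {i} {c} (s , s′) k< l =
      toggle-sealed V s k< l ,
      sealed-cong (λ j d k′≤ → sym (toggle-far V (i , c) (ρ (j , d))
        (far-left (≤-<-trans (s≤s (opposite-≤ d k′≤)) (sealed⇒beyond V s k< l))))) s′

  ρ-separates : ∀ {k k′} V → Separates k k′ V → Separates k′ k (V ∘ ρ)
  ρ-separates V (s , s′) = s′ , sealed-cong (λ i c _ → sym (cong V (ρ-involutive (i , c)))) s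

  -- Splitting a grid at a separator

  module Separator {k k′ : ℕ} (m≡ : k + suc k′ ≡ m) where

    m≡′ : k′ + suc k ≡ m
    m≡′ = trans (+-suc k′ k) (trans (cong suc (+-comm k′ k)) (trans (sym (+-suc k k′)) m≡))

    legal-rotated : ∀ V v → Legal V v → Legal (V ∘ ρ) (ρ v)
    legal-rotated V v l = legal-ρ⁻ V (V ∘ ρ) (λ _ → refl) (ρ v) (subst (Legal V) (sym (ρ-involutive v)) l)

    separates-toggle : ∀ V {v} → Separates k k′ V → Legal V v → Separates k k′ (toggle V v)
    separates-toggle V {v@(i , c)} sep@(s , s′) l with <-cmp k (toℕ c)
    ... | tri< k< _ _ = separates-toggle-right m≡ V sep k< l
    ... | tri≈ _ k≡ _ = contradiction (trans (sym (sealed⇒zero s i c (sym k≡))) (legal⇒false (ℒ₂ m) V l)) λ ()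
    ... | tri> _ _ c< with separates-toggle-right m≡′ (V ∘ ρ) (ρ-separates V sep) (opposite-< m≡ c c<) (legal-rotated V v l)
    ...   | t′ , t =
      sealed-cong (λ j d _ → trans (rotated (ρ (j , d))) (cong (toggle V v) (ρ-involutive (j , d)))) t ,
      sealed-cong (λ j d _ → rotated (j , d)) t′
      where
      rotated : ∀ w → toggle (V ∘ ρ) (ρ v) w ≡ toggle V v (ρ w)
      rotated w = trans (toggle-ρ V (V ∘ ρ) (λ _ → refl) (ρ v) w) (cong (λ u → toggle V u (ρ w)) (ρ-involutive v))

    separates⇒before : ∀ V {i c} → Separates k k′ V → toℕ c < k → Legal V (i , c) → suc (toℕ c) < k
    separates⇒before V {i} {c} (_ , s′) c< l = +-cancelʳ-≤ (suc k′) _ _ (begin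
      suc (suc (toℕ c)) + suc k′          ≡⟨ +-comm (suc (suc (toℕ c))) (suc k′) ⟩
      suc k′ + suc (suc (toℕ c))          ≡⟨ +-suc (suc k′) (suc (toℕ c)) ⟩
      suc (suc k′) + suc (toℕ c)          ≤⟨ +-monoˡ-≤ (suc (toℕ c)) (sealed⇒beyond (V ∘ ρ) s′ (opposite-< m≡ c c<) (legal-rotated V (i , c) l)) ⟩
      toℕ (opposite c) + suc (toℕ c)      ≡⟨ trans (opposite-+ c) (sym m≡) ⟩
      k + suc k′                          ∎)
      where open ≤-Reasoning

    sk≤m : suc k ≤ m
    sk≤m = subst (suc k ≤_) m≡ (subst (suc k ≤_) (sym (+-suc k k′)) (s≤s (m≤m+n k k′)))

    -- Both pieces keep column `k`, so that a cell next to the separator has the same neighbourhood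
    -- in its piece as in the whole grid. Hence the two widths add up to `m + 1`.
    leftCol : Fin (suc k) → Fin m
    leftCol c = inject≤ c sk≤m

    toℕ-leftCol : ∀ c → toℕ (leftCol c) ≡ toℕ c
    toℕ-leftCol c = Fin.toℕ-inject≤ c sk≤m

    rightCol : Fin (suc k′) → Fin m
    rightCol c = cast m≡ (k ↑ʳ c)

    toℕ-rightCol : ∀ c → toℕ (rightCol c) ≡ k + toℕ c
    toℕ-rightCol c = trans (Fin.toℕ-cast m≡ (k ↑ʳ c)) (Fin.toℕ-↑ʳ k c)

    left : GridVertex (suc k) → GridVertex m
    left = rowsCols id leftCol

    -- The rows are exchanged because the right part left behind by a move in
    -- row 0 of 𝒟 m is an upside-down ℋ.
    right : GridVertex (suc k′) → GridVertex m
    right = rowsCols opposite rightCol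

    left-injective : ∀ {v w} → left v ≡ left w → v ≡ w
    left-injective {v} {w} = rowsCols-injective id (λ _ → refl) leftCol
      (λ {c} {d} eq → Fin.inject≤-injective sk≤m sk≤m c d eq) {v} {w}

    right-injective : ∀ {v w} → right v ≡ right w → v ≡ w
    right-injective {v} {w} = rowsCols-injective opposite Fin.opposite-involutive rightCol
      (λ {c} {d} eq → Fin.toℕ-injective (+-cancelˡ-≡ k _ _
        (trans (sym (toℕ-rightCol c)) (trans (cong toℕ eq) (toℕ-rightCol d))))) {v} {w}

    leftCol-image : ∀ {e} → toℕ e < suc k → ∃ λ c → leftCol c ≡ e
    leftCol-image {e} e< = fromℕ< e< ,
      Fin.toℕ-injective (trans (toℕ-leftCol (fromℕ< e<)) (Fin.toℕ-fromℕ< e<))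

    rightCol-image : ∀ {e} → k ≤ toℕ e → ∃ λ c → rightCol c ≡ e
    rightCol-image {e} k≤ = fromℕ< e∸k< , Fin.toℕ-injective (trans (toℕ-rightCol (fromℕ< e∸k<))
      (trans (cong (k +_) (Fin.toℕ-fromℕ< e∸k<)) (m+[n∸m]≡n k≤)))
      where
      e∸k< : toℕ e ∸ k < suc k′
      e∸k< = +-cancelˡ-< k _ _ (subst₂ _<_ (sym (m+[n∸m]≡n k≤)) (sym m≡) (Fin.toℕ<n e))

    -- Weight 1 keeps `v` off the zero column `k`, the only one at which the left piece can cut off
    -- a neighbour.
    left-preservesN : ∀ V {v} → Separates k k′ V → V (left v) ≡ false → PreservesN (ℒ₂ (suc k)) (ℒ₂ m) left v
    left-preservesN V {i , c} (s , _) v1 = rowsCols-preservesN id (λ _ → refl) leftCol into onto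
      where
      c<k : toℕ c < k
      c<k = ≤∧≢⇒< (s≤s⁻¹ (Fin.toℕ<n c)) λ c≡k → contradiction
        (trans (sym (sealed⇒zero s i (leftCol c) (trans (toℕ-leftCol c) c≡k))) v1) λ ()
      into : ∀ {d} → Beside c d → Beside (leftCol c) (leftCol d)
      into {d} = subst₂ (λ x y → y ≡ suc x ⊎ x ≡ suc y) (sym (toℕ-leftCol c)) (sym (toℕ-leftCol d))
      from : ∀ {d} → Beside (leftCol c) (leftCol d) → Beside c d
      from {d} = subst₂ (λ x y → y ≡ suc x ⊎ x ≡ suc y) (toℕ-leftCol c) (toℕ-leftCol d)
      bound : ∀ {e} → Beside (leftCol c) e → toℕ e < suc k
      bound (inj₁ eq) = subst (_< suc k) (sym (trans eq (cong suc (toℕ-leftCol c)))) (s≤s c<k)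
      bound (inj₂ eq) = <-trans (subst (_ <_) (trans (sym eq) (toℕ-leftCol c)) (n<1+n _)) (<-trans c<k (n<1+n k))
      onto : ∀ {e} → Beside (leftCol c) e → ∃ λ d → Beside c d × leftCol d ≡ e
      onto beside with leftCol-image (bound beside)
      ... | d , refl = d , from beside , refl

    right-preservesN : ∀ V {v} → Separates k k′ V → V (right v) ≡ false → PreservesN (ℒ₂ (suc k′)) (ℒ₂ m) right v
    right-preservesN V {i , c} (s , _) v1 = rowsCols-preservesN opposite Fin.opposite-involutive rightCol into onto
      where
      k<c : k < toℕ (rightCol c)
      k<c = ≤∧≢⇒< (subst (k ≤_) (sym (toℕ-rightCol c)) (m≤m+n k _)) λ k≡ → contradiction
        (trans (sym (sealed⇒zero s (opposite i) (rightCol c) (sym k≡))) v1) λ ()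
      into : ∀ {d} → Beside c d → Beside (rightCol c) (rightCol d)
      into {d} = subst₂ (λ x y → y ≡ suc x ⊎ x ≡ suc y) (sym (toℕ-rightCol c)) (sym (toℕ-rightCol d)) ∘
        [ (λ eq → inj₁ (trans (cong (k +_) eq) (+-suc k _))) , (λ eq → inj₂ (trans (cong (k +_) eq) (+-suc k _))) ]
      from : ∀ {d} → Beside (rightCol c) (rightCol d) → Beside c d
      from {d} = [ (λ eq → inj₁ (+-cancelˡ-≡ k _ _ (trans eq (sym (+-suc k _))))) ,
                   (λ eq → inj₂ (+-cancelˡ-≡ k _ _ (trans eq (sym (+-suc k _))))) ] ∘
        subst₂ (λ x y → y ≡ suc x ⊎ x ≡ suc y) (toℕ-rightCol c) (toℕ-rightCol d)
      bound : ∀ {e} → Beside (rightCol c) e → k ≤ toℕ e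
      bound (inj₁ eq) = ≤-trans (<⇒≤ k<c) (≤-trans (n≤1+n _) (≤-reflexive (sym eq)))
      bound (inj₂ eq) = s≤s⁻¹ (subst (k <_) eq k<c)
      onto : ∀ {e} → Beside (rightCol c) e → ∃ λ d → Beside c d × rightCol d ≡ e
      onto beside with rightCol-image (bound beside)
      ... | d , refl = d , from beside , refl

    -- A legal move leaves a free column between itself and the separator (`sealed⇒beyond`,
    -- `separates⇒before`), so its neighbourhood avoids even the column shared by the two pieces.
    cover : ∀ V {v} → Separates k k′ V → Legal V v →
      (∃ λ a → left a ≡ v × (∀ b → ¬ Graph.InN[_] (ℒ₂ m) v (right b))) ⊎
      (∃ λ b → right b ≡ v × (∀ a → ¬ Graph.InN[_] (ℒ₂ m) v (left a)))
    cover V {v@(i , c)} sep@(s , _) l with <-cmp k (toℕ c)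
    ... | tri≈ _ k≡ _ = contradiction (trans (sym (sealed⇒zero s i c (sym k≡))) (legal⇒false (ℒ₂ m) V l)) λ ()
    ... | tri< k< _ _ with rightCol-image (<⇒≤ k<)
    ...   | d , refl = inj₂ ((opposite i , d) , cong (_, rightCol d) (Fin.opposite-involutive i) , λ (j , e) near →
              far-left (≤-<-trans (s≤s (subst (_≤ k) (sym (toℕ-leftCol e)) (s≤s⁻¹ (Fin.toℕ<n e)))) (sealed⇒beyond V s k< l))
                (inN⇒near v (left (j , e)) near))
    cover V {v@(i , c)} sep l | tri> _ _ c< with leftCol-image (<-trans c< (n<1+n k))
    ...   | d , refl = inj₁ ((i , d) , refl , λ (j , e) near →
              far-right (<-≤-trans (separates⇒before V sep c< l) (subst (k ≤_) (sym (toℕ-rightCol e)) (m≤m+n k _)))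
                (inN⇒near v (right (j , e)) near))

    nimber-split : ∀ V Q R → Separates k k′ V → (∀ a → Q a ≡ V (left a)) → (∀ b → R b ≡ V (right b)) →
      nimber V ≡ Toggle.nimber (ℒ₂ (suc k)) Q ⊕ Toggle.nimber (ℒ₂ (suc k′)) R
    nimber-split V Q R = Gluing.nimber-⊕ (ℒ₂ m) (ℒ₂ (suc k)) (ℒ₂ (suc k′)) (Separates k k′) left right
      left-injective right-injective (λ {V} → left-preservesN V) (λ {V} → right-preservesN V)
      (λ {V} → separates-toggle V) (λ {V} → cover V) {V} {Q} {R}

-- The positions 𝒟 and ℋ

-- Columns are numbered from 0 here: ZeroD n and ZeroH n describe 𝒟 (3 + n) and ℋ (3 + n).
ZeroD : ℕ → Fin 2 → ℕ → Set
ZeroD n 0F t = t ≡ 0 ⊎ t ≡ 1 + n ⊎ t ≡ 2 + n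
ZeroD n 1F t = t ≡ 0 ⊎ t ≡ 1 ⊎ t ≡ 2 + n

zeroD? : ∀ n i t → Dec (ZeroD n i t)
zeroD? n 0F t = (t ℕ.≟ 0) ⊎-dec (t ℕ.≟ 1 + n) ⊎-dec (t ℕ.≟ 2 + n)
zeroD? n 1F t = (t ℕ.≟ 0) ⊎-dec (t ℕ.≟ 1) ⊎-dec (t ℕ.≟ 2 + n)

ZeroH : ℕ → Fin 2 → ℕ → Set
ZeroH zero    _  t = t ≡ 0 ⊎ t ≡ 2
ZeroH (suc n) 0F t = t ≡ 0 ⊎ t ≡ 3 + n
ZeroH (suc n) 1F t = t ≡ 0 ⊎ t ≡ 1 ⊎ t ≡ 2 + n ⊎ t ≡ 3 + n

zeroH? : ∀ n i t → Dec (ZeroH n i t)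
zeroH? zero    _  t = (t ℕ.≟ 0) ⊎-dec (t ℕ.≟ 2)
zeroH? (suc n) 0F t = (t ℕ.≟ 0) ⊎-dec (t ℕ.≟ 3 + n)
zeroH? (suc n) 1F t = (t ℕ.≟ 0) ⊎-dec (t ℕ.≟ 1) ⊎-dec (t ℕ.≟ 2 + n) ⊎-dec (t ℕ.≟ 3 + n)

D₀ : ∀ n → GridVertex (3 + n) → Bool
D₀ n = Position.V₀ (𝒟 (3 + n))

-- `ℋ` matches on the literal 3, so `ℋ (3 + n)` reduces only after `n` is split; the splitting is
-- done here once, under a uniform type.
H₀ : ∀ n → GridVertex (3 + n) → Bool
H₀ zero    = Position.V₀ (ℋ 3)
H₀ (suc n) = Position.V₀ (ℋ (4 + n))

𝒢-ℋ : ∀ n → 𝒢 (ℋ (3 + n)) ≡ Toggle.nimber (ℒ₂ (3 + n)) (H₀ n)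
𝒢-ℋ zero    = refl
𝒢-ℋ (suc n) = refl

-- Membership in an explicit list computes to a disjunction ending in false.
D₀-does : ∀ n i c → D₀ n (i , c) ≡ does (zeroD? n i (toℕ c))
D₀-does n 0F c = cong (λ x → (toℕ c ≡ᵇ 0) ∨ (toℕ c ≡ᵇ 1 + n) ∨ x) (∨-identityʳ _)
D₀-does n 1F c = cong (λ x → (toℕ c ≡ᵇ 0) ∨ (toℕ c ≡ᵇ 1) ∨ x) (∨-identityʳ _)

H₀-does : ∀ n i c → H₀ n (i , c) ≡ does (zeroH? n i (toℕ c))
H₀-does zero    0F c = cong ((toℕ c ≡ᵇ 0) ∨_) (∨-identityʳ _)
H₀-does zero    1F c = cong ((toℕ c ≡ᵇ 0) ∨_) (∨-identityʳ _)
H₀-does (suc n) 0F c = cong ((toℕ c ≡ᵇ 0) ∨_) (∨-identityʳ _)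
H₀-does (suc n) 1F c = cong (λ x → (toℕ c ≡ᵇ 0) ∨ (toℕ c ≡ᵇ 1) ∨ (toℕ c ≡ᵇ 2 + n) ∨ x) (∨-identityʳ _)

D₀-zero : ∀ n i c → ZeroD n i (toℕ c) → D₀ n (i , c) ≡ true
D₀-zero n i c z = trans (D₀-does n i c) (dec-true (zeroD? n i (toℕ c)) z)

D₀-one : ∀ n i c → ¬ ZeroD n i (toℕ c) → D₀ n (i , c) ≡ false
D₀-one n i c ¬z = trans (D₀-does n i c) (dec-false (zeroD? n i (toℕ c)) ¬z)

H₀-zero : ∀ n i c → ZeroH n i (toℕ c) → H₀ n (i , c) ≡ true
H₀-zero n i c z = trans (H₀-does n i c) (dec-true (zeroH? n i (toℕ c)) z)

H₀-one : ∀ n i c → ¬ ZeroH n i (toℕ c) → H₀ n (i , c) ≡ false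
H₀-one n i c ¬z = trans (H₀-does n i c) (dec-false (zeroH? n i (toℕ c)) ¬z)

zeroD-opposite : ∀ n i s t → t + suc s ≡ 3 + n → ZeroD n i s → ZeroD n (opposite i) t
zeroD-opposite n 0F s t eq (inj₁ refl) = inj₂ (inj₂ (suc-injective (trans (+-comm 1 t) eq)))
zeroD-opposite n 0F s t eq (inj₂ (inj₁ refl)) = inj₂ (inj₁ (+-cancelʳ-≡ (2 + n) t 1 eq))
zeroD-opposite n 0F s t eq (inj₂ (inj₂ refl)) = inj₁ (+-cancelʳ-≡ (3 + n) t 0 eq)
zeroD-opposite n 1F s t eq (inj₁ refl) = inj₂ (inj₂ (suc-injective (trans (+-comm 1 t) eq)))
zeroD-opposite n 1F s t eq (inj₂ (inj₁ refl)) = inj₂ (inj₁ (+-cancelʳ-≡ 2 t (1 + n) (trans eq (+-comm 2 (1 + n)))))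
zeroD-opposite n 1F s t eq (inj₂ (inj₂ refl)) = inj₁ (+-cancelʳ-≡ (3 + n) t 0 eq)

D₀-ρ : ∀ n w → D₀ n w ≡ D₀ n (ρ w)
D₀-ρ n (i , c) = trans (D₀-does n i c) (trans
  (does-⇔ (mk⇔ (zeroD-opposite n i (toℕ c) (toℕ (opposite c)) (opposite-+ c)) back)
    (zeroD? n i (toℕ c)) (zeroD? n (opposite i) (toℕ (opposite c))))
  (sym (D₀-does n (opposite i) (opposite c))))
  where
  back : ZeroD n (opposite i) (toℕ (opposite c)) → ZeroD n i (toℕ c)
  back z = subst (λ j → ZeroD n j (toℕ c)) (Fin.opposite-involutive i)
    (zeroD-opposite n (opposite i) (toℕ (opposite c)) (toℕ c)
      (trans (+-suc (toℕ c) _) (trans (cong suc (+-comm (toℕ c) _)) (trans (sym (+-suc _ (toℕ c))) (opposite-+ c)))) z)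

-- `ℋ 3` departs from the general pattern only in column 1 of row 1, treated in `H₀-bottom-1`. Row
-- 0, and row 1 from column 2 on, admit one formula for all `b`.
zeroH-top : ∀ b s → ZeroH b 0F s ⇔ (s ≡ 0 ⊎ s ≡ 2 + b)
zeroH-top zero    s = mk⇔ id id
zeroH-top (suc b) s = mk⇔ id id

zeroH-bottom : ∀ b s → ZeroH b 1F (2 + s) ⇔ (2 + s ≡ 1 + b ⊎ 2 + s ≡ 2 + b)
zeroH-bottom zero    s = mk⇔ (λ { (inj₁ ()) ; (inj₂ eq) → inj₂ eq }) (λ { (inj₁ ()) ; (inj₂ eq) → inj₂ eq })
zeroH-bottom (suc b) s = mk⇔ (λ { (inj₁ ()) ; (inj₂ (inj₁ ())) ; (inj₂ (inj₂ z)) → z }) (inj₂ ∘ inj₂)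

H₀-corner : ∀ b i c → toℕ c ≡ 0 → H₀ b (i , c) ≡ true
H₀-corner zero    i  c c≡ = H₀-zero zero i c (inj₁ c≡)
H₀-corner (suc b) 0F c c≡ = H₀-zero (suc b) 0F c (inj₁ c≡)
H₀-corner (suc b) 1F c c≡ = H₀-zero (suc b) 1F c (inj₁ c≡)

H₀-bottom-1 : ∀ b c → toℕ c ≡ 1 → H₀ b (1F , c) ≡ not (does (b ℕ.≟ 0))
H₀-bottom-1 zero    c c≡ = H₀-one zero 1F c (subst (¬_ ∘ ZeroH zero 1F) (sym c≡) λ { (inj₁ ()) ; (inj₂ ()) })
H₀-bottom-1 (suc b) c c≡ = H₀-zero (suc b) 1F c (inj₂ (inj₁ c≡))

-- The move v_{0,3+a} in 𝒟 (3 + n), where 3 + n = 5 + a + b.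
module TopMove (n a b : ℕ) (n≡ : n ≡ 2 + (a + b)) (c : Fin (3 + n)) (c≡ : toℕ c ≡ 2 + a) where
  k k′ : ℕ
  k  = 2 + a
  k′ = 2 + b

  open Toggle (ℒ₂ (3 + n))

  V V′ : GridVertex (3 + n) → Bool
  V  = D₀ n
  V′ = toggle V (0F , c)

  m≡ : k + suc k′ ≡ 3 + n
  m≡ = trans (cong (2 +_) (trans (+-suc a (2 + b)) (cong suc (trans (+-suc a (1 + b)) (cong suc (+-suc a b))))))
             (cong (3 +_) (sym n≡))

  private
    3+a≤1+n : 3 + a ≤ 1 + n
    3+a≤1+n = subst (3 + a ≤_) (cong suc (sym n≡)) (+-monoʳ-≤ 3 (m≤m+n a b))
    ≢1+n : ∀ {t} → t < 3 + a → t ≢ 1 + n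
    ≢1+n t< = <⇒≢ (<-≤-trans t< 3+a≤1+n)
    ≢2+n : ∀ {t} → t < 3 + a → t ≢ 2 + n
    ≢2+n t< = <⇒≢ (<-trans (<-≤-trans t< 3+a≤1+n) (n<1+n _))

  k-one : ∀ i d → toℕ d ≡ k → V (i , d) ≡ false
  k-one 0F d d≡ = D₀-one n 0F d (subst (¬_ ∘ ZeroD n 0F) (sym d≡)
    λ { (inj₁ ()) ; (inj₂ (inj₁ eq)) → ≢1+n ≤-refl eq ; (inj₂ (inj₂ eq)) → ≢2+n ≤-refl eq })
  k-one 1F d d≡ = D₀-one n 1F d (subst (¬_ ∘ ZeroD n 1F) (sym d≡)
    λ { (inj₁ ()) ; (inj₂ (inj₁ ())) ; (inj₂ (inj₂ eq)) → ≢2+n ≤-refl eq })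

  before-one : ∀ d → toℕ d ≡ 1 + a → V (0F , d) ≡ false
  before-one d d≡ = D₀-one n 0F d (subst (¬_ ∘ ZeroD n 0F) (sym d≡)
    λ { (inj₁ ()) ; (inj₂ (inj₁ eq)) → ≢1+n (n≤1+n _) eq ; (inj₂ (inj₂ eq)) → ≢2+n (n≤1+n _) eq })

  -- The three ones are the chosen cell, its left neighbour and the cell below. The right neighbour
  -- would not serve, being a zero when `b` is 0.
  legal : Legal V (0F , c)
  legal = three-ones⇒legal (ℒ₂ (3 + n)) {V} {0F , c} {0F , d} {1F , c} (N-length (0F , c))
    (λ eq → <⇒≢ (n<1+n (1 + a)) (trans (sym d≡) (trans (cong (toℕ ∘ proj₂) (sym eq)) c≡)))
    (λ ()) (λ ())
    (near⇒inN (0F , c) (0F , d) (inj₂ (refl , inj₂ (trans c≡ (cong suc (sym d≡))))))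
    (near⇒inN (0F , c) (1F , c) (inj₁ refl))
    (k-one 0F c c≡) (before-one d d≡) (k-one 1F c c≡)
    where
    d : Fin (3 + n)
    d = proj₁ (column (<-trans (n<1+n (1 + a)) (subst (_< 3 + n) c≡ (Fin.toℕ<n c))))
    d≡ : toℕ d ≡ 1 + a
    d≡ = proj₂ (column (<-trans (n<1+n (1 + a)) (subst (_< 3 + n) c≡ (Fin.toℕ<n c))))

  private
    flipped : ∀ w {x} → Near (0F , c) w → V w ≡ x → V′ w ≡ not x
    flipped w near eq = trans (toggle-inside (ℒ₂ (3 + n)) V (0F , c) w (near⇒inN (0F , c) w near)) (cong not eq)

  k-zero′ : ∀ i d → toℕ d ≡ k → V′ (i , d) ≡ true
  k-zero′ i d d≡ = flipped (i , d) (inj₁ (Fin.toℕ-injective (trans d≡ (sym c≡)))) (k-one i d d≡)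

  before-zero′ : ∀ d → toℕ d ≡ 1 + a → V′ (0F , d) ≡ true
  before-zero′ d d≡ = flipped (0F , d) (inj₂ (refl , inj₂ (trans c≡ (cong suc (sym d≡))))) (before-one d d≡)

  after′ : ∀ d {x} → toℕ d ≡ 3 + a → V (0F , d) ≡ x → V′ (0F , d) ≡ not x
  after′ d d≡ = flipped (0F , d) (inj₂ (refl , inj₁ (trans d≡ (cong suc (sym c≡)))))

  unchanged : ∀ i d t → toℕ d ≡ t → t ≢ k → (i ≡ 0F → t ≢ 1 + a × t ≢ 3 + a) →
    V′ (i , d) ≡ does (zeroD? n i t)
  unchanged i d _ refl ≢k ≢ = trans (toggle-far V (0F , c) (i , d) λ
    { (inj₁ refl) → ≢k c≡
    ; (inj₂ (i≡ , inj₁ eq)) → proj₂ (≢ i≡) (trans eq (cong suc c≡))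
    ; (inj₂ (i≡ , inj₂ eq)) → proj₁ (≢ i≡) (suc-injective (trans (sym eq) c≡)) }) (D₀-does n i d)

  open Separator {3 + n} {k} {k′} m≡

  -- The three zeros at the left end of `𝒟 (3 + a)` are inherited from `𝒟 (3 + n)`; the three at its
  -- right end are made by the move.
  left-piece : ∀ w → D₀ a w ≡ V′ (left w)
  left-piece (i , d) with toℕ d ℕ.≟ k
  left-piece (0F , d) | yes d≡ = trans (D₀-zero a 0F d (inj₂ (inj₂ d≡))) (sym (k-zero′ 0F (leftCol d) (trans (toℕ-leftCol d) d≡)))
  left-piece (1F , d) | yes d≡ = trans (D₀-zero a 1F d (inj₂ (inj₂ d≡))) (sym (k-zero′ 1F (leftCol d) (trans (toℕ-leftCol d) d≡)))
  left-piece (1F , d) | no d≢ = trans (D₀-does a 1F d) (trans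
    (does-⇔ (mk⇔
      (λ { (inj₁ eq) → inj₁ eq ; (inj₂ (inj₁ eq)) → inj₂ (inj₁ eq) ; (inj₂ (inj₂ eq)) → contradiction eq d≢ })
      (λ { (inj₁ eq) → inj₁ eq ; (inj₂ (inj₁ eq)) → inj₂ (inj₁ eq)
         ; (inj₂ (inj₂ eq)) → contradiction eq (≢2+n (Fin.toℕ<n d)) }))
      (zeroD? a 1F (toℕ d)) (zeroD? n 1F (toℕ d)))
    (sym (unchanged 1F (leftCol d) (toℕ d) (toℕ-leftCol d) d≢ λ ())))
  left-piece (0F , d) | no d≢ with toℕ d ℕ.≟ 1 + a
  ... | yes d≡ = trans (D₀-zero a 0F d (inj₂ (inj₁ d≡))) (sym (before-zero′ (leftCol d) (trans (toℕ-leftCol d) d≡)))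
  ... | no d≢′ = trans (D₀-does a 0F d) (trans
    (does-⇔ (mk⇔
      (λ { (inj₁ eq) → inj₁ eq ; (inj₂ (inj₁ eq)) → contradiction eq d≢′ ; (inj₂ (inj₂ eq)) → contradiction eq d≢ })
      (λ { (inj₁ eq) → inj₁ eq
         ; (inj₂ (inj₁ eq)) → contradiction eq (≢1+n (Fin.toℕ<n d))
         ; (inj₂ (inj₂ eq)) → contradiction eq (≢2+n (Fin.toℕ<n d)) }))
      (zeroD? a 0F (toℕ d)) (zeroD? n 0F (toℕ d)))
    (sym (unchanged 0F (leftCol d) (toℕ d) (toℕ-leftCol d) d≢ λ _ → d≢′ , <⇒≢ (Fin.toℕ<n d))))

  private
    n-shift : 2 + n ≡ k + (2 + b)
    n-shift = suc-injective (trans (sym m≡) (+-suc k (2 + b)))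
    n-shift′ : 1 + n ≡ k + (1 + b)
    n-shift′ = suc-injective (trans n-shift (+-suc k (1 + b)))

  -- This cell decides the shape of the right piece. For `b` equal to 0 it is an end zero of `𝒟`,
  -- which the move turns into the one that sets `ℋ 3` apart; otherwise the move makes it a zero.
  after-k : ∀ d → toℕ d ≡ 3 + a → V (0F , d) ≡ does (b ℕ.≟ 0)
  after-k d d≡ = trans (D₀-does n 0F d) (does-⇔ (mk⇔ to from) (zeroD? n 0F (toℕ d)) (b ℕ.≟ 0))
    where
    to : ZeroD n 0F (toℕ d) → b ≡ 0
    to (inj₁ eq) = contradiction (trans (sym d≡) eq) λ ()
    to (inj₂ (inj₁ eq)) = sym (+-cancelˡ-≡ (3 + a) 0 b
      (trans (+-identityʳ (3 + a)) (trans (sym d≡) (trans eq (cong suc n≡)))))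
    to (inj₂ (inj₂ eq)) = contradiction (trans (sym d≡) eq) (<⇒≢ (s≤s 3+a≤1+n))
    from : b ≡ 0 → ZeroD n 0F (toℕ d)
    from b≡0 = inj₂ (inj₁ (trans d≡ (cong suc (trans (cong (2 +_) (trans (sym (+-identityʳ a)) (cong (a +_) (sym b≡0)))) (sym n≡)))))

  right-piece : ∀ w → H₀ b w ≡ V′ (right w)
  right-piece (i , d) with toℕ d in d≡
  ... | zero = trans (H₀-corner b i d d≡)
                 (sym (k-zero′ (opposite i) (rightCol d) (trans (toℕ-rightCol d) (trans (cong (k +_) d≡) (+-identityʳ k)))))
  right-piece (0F , d) | suc s = trans (H₀-does b 0F d) (trans
    (does-⇔ (mk⇔ to from) (zeroH? b 0F (toℕ d)) (zeroD? n 1F (k + suc s)))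
    (sym (unchanged 1F (rightCol d) (k + suc s) (trans (toℕ-rightCol d) (cong (k +_) d≡)) (m+1+n≢m k) λ ())))
    where
    to : ZeroH b 0F (toℕ d) → ZeroD n 1F (k + suc s)
    to z with Equivalence.to (zeroH-top b (toℕ d)) z
    ... | inj₁ eq = contradiction (trans (sym d≡) eq) λ ()
    ... | inj₂ eq = inj₂ (inj₂ (trans (cong (k +_) (trans (sym d≡) eq)) (sym n-shift)))
    from : ZeroD n 1F (k + suc s) → ZeroH b 0F (toℕ d)
    from (inj₂ (inj₂ eq)) = Equivalence.from (zeroH-top b (toℕ d))
      (inj₂ (trans d≡ (+-cancelˡ-≡ k _ _ (trans eq n-shift))))
  right-piece (1F , d) | suc zero = trans (H₀-bottom-1 b d d≡) (sym (after′ (rightCol d) d≡′ (after-k (rightCol d) d≡′)))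
    where
    d≡′ : toℕ (rightCol d) ≡ 3 + a
    d≡′ = trans (toℕ-rightCol d) (trans (cong (k +_) d≡) (+-comm k 1))
  right-piece (1F , d) | suc (suc s) = trans (H₀-does b 1F d) (trans
    (does-⇔ (mk⇔ to from) (zeroH? b 1F (toℕ d)) (zeroD? n 0F (k + (2 + s))))
    (sym (unchanged 0F (rightCol d) (k + (2 + s)) (trans (toℕ-rightCol d) (cong (k +_) d≡)) (m+1+n≢m k) λ _ →
      (λ eq → <⇒≢ (<-≤-trans (n<1+n (1 + a)) (m≤m+n k (2 + s))) (sym eq)) ,
      (λ eq → m+1+n≢m (3 + a) (trans (cong (2 +_) (sym (+-suc a (suc s)))) eq)))))
    where
    to : ZeroH b 1F (toℕ d) → ZeroD n 0F (k + (2 + s))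
    to z with Equivalence.to (zeroH-bottom b s) (subst (ZeroH b 1F) d≡ z)
    ... | inj₁ eq = inj₂ (inj₁ (trans (cong (k +_) eq) (sym n-shift′)))
    ... | inj₂ eq = inj₂ (inj₂ (trans (cong (k +_) eq) (sym n-shift)))
    from : ZeroD n 0F (k + (2 + s)) → ZeroH b 1F (toℕ d)
    from (inj₂ z) = subst (ZeroH b 1F) (sym d≡) (Equivalence.from (zeroH-bottom b s)
      (map-⊎ (λ eq → +-cancelˡ-≡ k _ _ (trans eq n-shift′)) (λ eq → +-cancelˡ-≡ k _ _ (trans eq n-shift)) z))

  separated : Separates k k′ V′
  -- The guard on the left is always the cell of row 0 in column `1 + a`, which the move made zero;
  -- the half turn puts it in row 1.
  separated = sealed-right , guarded zs 1F z
    where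
    zs : ∀ i → ZeroAt (V′ ∘ ρ) i k′
    zs i d d≡ = k-zero′ (opposite i) (opposite d) (+-cancelʳ-≡ (suc k′) _ _
      (trans (cong (λ x → toℕ (opposite d) + suc x) (sym d≡)) (trans (opposite-+ d) (sym m≡))))
    z : ZeroAt (V′ ∘ ρ) 1F (suc k′)
    z d d≡ = before-zero′ (opposite d) (+-cancelʳ-≡ (suc (suc k′)) _ _
      (trans (cong (λ x → toℕ (opposite d) + suc x) (sym d≡)) (trans (opposite-+ d) (trans (sym m≡) (sym (+-suc (1 + a) (suc k′)))))))
    sealed-right : Sealed V′ k
    sealed-right with b ℕ.≟ 0 in eq
    ... | no b≢0 = guarded k-zero′ 0F λ d d≡ → trans (after′ d d≡ (after-k d d≡)) (cong (not ∘ does) eq)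
    -- The cell to the right of the move has become a one and cannot guard. Column `4 + a` is now
    -- the last column and is zero; its own guard would lie outside the grid, so that condition is
    -- vacuous.
    ... | yes b≡0 = skip k-zero′ (s≤s (s≤s 3+a≤1+n))
      (guarded last 0F λ d d≡ → contradiction (trans d≡ (cong (3 +_) 2+a≡n)) (<⇒≢ (Fin.toℕ<n d)))
      where
      2+a≡n : 2 + a ≡ n
      2+a≡n = trans (cong (2 +_) (trans (sym (+-identityʳ a)) (cong (a +_) (sym b≡0)))) (sym n≡)
      last : ∀ i → ZeroAt V′ i (4 + a)
      last i d d≡ = trans (unchanged i d (4 + a) d≡ (λ ()) (λ _ → (λ ()) , (λ ())))
        (dec-true (zeroD? n i (4 + a)) (end i))
        where
        end : ∀ i → ZeroD n i (4 + a)
        end 0F = inj₂ (inj₂ (cong (2 +_) 2+a≡n))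
        end 1F = inj₂ (inj₂ (cong (2 +_) 2+a≡n))

  nimber-V′ : nimber V′ ≡ 𝒢 (ℋ (3 + b)) ⊕ 𝒢 (𝒟 (3 + a))
  nimber-V′ = trans (nimber-split V′ (D₀ a) (H₀ b) separated left-piece right-piece)
    (trans (⊕-comm (𝒢 (𝒟 (3 + a))) (Toggle.nimber (ℒ₂ (3 + b)) (H₀ b)))
      (cong (_⊕ 𝒢 (𝒟 (3 + a))) (sym (𝒢-ℋ b))))

-- The options of `𝒟 (3 + n)`

module _ (n : ℕ) where
  open Toggle (ℒ₂ (3 + n))

  option : ℕ → ℕ
  option i = 𝒢 (ℋ i) ⊕ 𝒢 (𝒟 (3 + n + 1 ∸ i))

  options : List ℕ
  options = map option [ 3 ⋯ 1 + n ]

  -- j is a variable because comparing 𝒢 of compound widths makes Agda unfold the games.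
  nimber-top : ∀ a b j → n ≡ 2 + (a + b) → j ≡ 3 + a → ∀ c → toℕ c ≡ 2 + a →
    nimber (toggle (D₀ n) (0F , c)) ≡ 𝒢 (ℋ (3 + b)) ⊕ 𝒢 (𝒟 j)
  nimber-top a b _ n≡ refl = TopMove.nimber-V′ n a b n≡

  width : ∀ a b → n ≡ 2 + (a + b) → 3 + n + 1 ∸ (3 + b) ≡ 3 + a
  width a b n≡ = trans (cong (λ x → x + 1 ∸ b) n≡)
    (trans (cong (λ x → 2 + x ∸ b) (+-comm (a + b) 1)) (m+n∸n≡m (3 + a) b))

  -- Row 0 is zero in column 0 and in the last two columns. In column 1, the corner on the left and
  -- the cell below are two zeros. The remaining columns run from 2 to `n`, and `a`, `b` measure the
  -- distances to these two ends.
  legal-top : ∀ c → Legal (D₀ n) (0F , c) → ∃₂ λ a b → n ≡ 2 + (a + b) × toℕ c ≡ 2 + a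
  legal-top c l = by-column (toℕ c) refl
    where
    nonzero : ∀ {t} → toℕ c ≡ t → ¬ ZeroD n 0F t
    nonzero refl z = contradiction (trans (sym (D₀-zero n 0F c z)) (legal⇒false (ℒ₂ (3 + n)) (D₀ n) {0F , c} l)) λ ()
    by-column : ∀ t → toℕ c ≡ t → ∃₂ λ a b → n ≡ 2 + (a + b) × toℕ c ≡ 2 + a
    by-column 0 c≡ = contradiction (inj₁ refl) (nonzero c≡)
    by-column 1 c≡ = contradiction l (two-near-zeros⇒illegal (D₀ n) {0F , c} (0F , 0F) (1F , c) (λ ())
      (inj₂ (refl , inj₂ c≡)) (inj₁ refl) (D₀-zero n 0F 0F (inj₁ refl)) (D₀-zero n 1F c (inj₂ (inj₁ c≡))))
    by-column (suc (suc a)) c≡ = a , n ∸ (2 + a) , sym (m+[n∸m]≡n 2+a≤n) , c≡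
      where
      2+a≤n : 2 + a ≤ n
      2+a≤n = s≤s⁻¹ (≤∧≢⇒< (s≤s⁻¹ (≤∧≢⇒< (s≤s⁻¹ (subst (_< 3 + n) c≡ (Fin.toℕ<n c)))
        (nonzero c≡ ∘ inj₂ ∘ inj₂))) (nonzero c≡ ∘ inj₂ ∘ inj₁))

  nimber-top∈ : ∀ c → Legal (D₀ n) (0F , c) → nimber (toggle (D₀ n) (0F , c)) ∈ options
  nimber-top∈ c l =
    let a , b , n≡ , c≡ = legal-top c l
    in subst (_∈ options) (sym (nimber-top a b (3 + n + 1 ∸ (3 + b)) n≡ (width a b n≡) c c≡))
         -- `[ 3 ⋯ 1 + n ]` unfolds to `map (3 +_) (upTo (n ∸ 1))`, so the index `3 + b` needs
         -- `b < n ∸ 1`.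
         (∈-map⁺ option (∈-map⁺ (3 +_) (∈-upTo⁺ (subst (λ n → b < n ∸ 1) (sym n≡) (s≤s (m≤n+m b a))))))

  nimber-rotated : ∀ v → nimber (toggle (D₀ n) v) ≡ nimber (toggle (D₀ n) (ρ v))
  nimber-rotated v = nimber-ρ (toggle (D₀ n) v) (toggle (D₀ n) (ρ v)) λ w →
    trans (toggle-ρ (D₀ n) (D₀ n) (D₀-ρ n) (ρ v) w) (cong (λ u → toggle (D₀ n) u (ρ w)) (ρ-involutive v))

  nimber∈ : ∀ v → Legal (D₀ n) v → nimber (toggle (D₀ n) v) ∈ options
  nimber∈ (0F , c) l = nimber-top∈ c l
  nimber∈ (1F , c) l = subst (_∈ options) (sym (nimber-rotated (1F , c)))
    (nimber-top∈ (opposite c) (legal-ρ⁻ (D₀ n) (D₀ n) (D₀-ρ n) (0F , opposite c)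
      (subst (Legal (D₀ n)) (sym (ρ-involutive (1F , c))) l)))

  Attained : ℕ → Set
  Attained j = ∃ λ v → Legal (D₀ n) v × nimber (toggle (D₀ n) v) ≡ j

  -- Moves in row 0 suffice here, since those in row 1 only repeat their values.
  option-attained : ∀ a b → n ≡ 2 + (a + b) → Attained (𝒢 (ℋ (3 + b)) ⊕ 𝒢 (𝒟 (3 + n + 1 ∸ (3 + b))))
  option-attained a b n≡ =
    let c , c≡ = column (subst (2 + a <_) (cong (3 +_) (sym n≡)) (s≤s (s≤s (s≤s (≤-trans (m≤m+n a b) (m≤n+m (a + b) 2))))))
    in (0F , c) , TopMove.legal n a b n≡ c c≡ , nimber-top a b (3 + n + 1 ∸ (3 + b)) n≡ (width a b n≡) c c≡

  options-attained : ∀ {j} → j ∈ options → Attained j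
  options-attained j∈ =
    let i , i∈ , j≡ = ∈-map⁻ option j∈
        b , b∈ , i≡ = ∈-map⁻ (3 +_) i∈
    in subst Attained (sym (trans j≡ (cong option i≡)))
         (option-attained (n ∸ (2 + b)) b (split b n (∈-upTo⁻ b∈)))
    where
    split : ∀ b n → b < n ∸ 1 → n ≡ 2 + ((n ∸ (2 + b)) + b)
    split b (suc n) b< = trans (sym (m+[n∸m]≡n (s≤s b<))) (cong (2 +_) (+-comm b (suc n ∸ (2 + b))))

proposition3p4 : ∀ (m : ℕ) → 3 ≤ m →
    𝒢 (𝒟 m) ≡ mex (map (λ i → 𝒢 (ℋ i) ⊕ 𝒢 (𝒟 (m + 1 ∸ i))) [ 3 ⋯ m ∸ 2 ])
proposition3p4 (suc (suc (suc n))) (s≤s (s≤s (s≤s z≤n))) = nimber-unique (ℒ₂ (3 + n)) {D₀ n}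
  (λ {v} l eq → mex-∉ (options n) (subst (_∈ options n) eq (nimber∈ n v l)))
  (λ j< → options-attained n (mex-least (options n) j<))
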